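{- For all integers $n>0$ and $k>0$, \[ |\mathcal{C}_n^k|=\sum_{j=0}^{k}\left\langle k\atop j\right\rangle\sum_{m=0}^{j+1}\binom{j+1}{m}(m+k-j)!\,{n\brace m+k-j}=B_{n,k}. \]
   Context: A Callan permutation of $[n+k]=\{1,2,\ldots,n+k\}$ is a permutation (written as a word $\pi_1\pi_2\cdots\pi_{n+k}$) such that every substring of consecutive entries all of whose entries lie in $N=\{1,\ldots,n\}$, or all of whose entries lie in $K=\{n+1,\ldots,n+k\}$, is increasing. $\mathcal{C}_n^k$ denotes the set of Callan permutations of $[n+k]$. The poly-Bernoulli numbers are defined by $\sum_{n\ge 0}B_n^{(k)}\frac{x^n}{n!}=\frac{\mathrm{Li}_k(1-e^{ -x})}{1-e^{ -x}}$ with $\mathrm{Li}_k(z)=\sum_{i\ge1} z^i/i^k$, and $B_{n,k}:=B_n^{(-k)}$. The Eulerian number $\left\langle k\atop j\right\rangle$ is the number of permutations of $[k]$ with exactly $j-1$ descents (equivalently, with $j$ maximal ascending runs); in particular $\left\langle k\atop 0\right\rangle=0$ for $k>0$. ${n\brace r}$ denotes the Stirling number of the second kind (number of partitions of an $n$-element set into $r$ nonempty blocks), with ${n\brace r}=0$ for $r=0<n$ or $r>n$. -}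

module Defs where

open import Data.Bool using (Bool; true; false; _∧_; _∨_; not; T)
open import Data.Nat as ℕ using (ℕ; zero; suc; _+_; _*_; _∸_; _^_; _!; _<ᵇ_; _≤ᵇ_; _≡ᵇ_)
open import Data.Nat.Properties using (_!≢0)
open import Data.Nat.Combinatorics using (_C_)
open import Data.Integer using (ℤ; +_; -[1+_])
open import Data.Fin using (Fin; toℕ)
open import Data.Vec using (Vec; []; _∷_; toList)
open import Data.List as List using (List; []; _∷_; length; map; concatMap; filterᵇ; allFin)
open import Data.Rational as ℚ using (ℚ; 0ℚ; 1ℚ; _/_)
open import Data.Product using (Σ)

sumℕ : ℕ → (ℕ → ℕ) → ℕ
sumℕ zero    f = f 0
sumℕ (suc n) f = sumℕ n f + f (suc n)

sumℚ : ℕ → (ℕ → ℚ) → ℚ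
sumℚ zero    f = f 0
sumℚ (suc n) f = sumℚ n f ℚ.+ f (suc n)

-- Words.  A word of length L over [m] is a  Vec (Fin m) L ; the value
-- i : Fin m stands for the integer  toℕ i + 1  of  [m] = {1,…,m}.

prefixes : {A : Set} → List A → List (List A)
prefixes []       = []
prefixes (x ∷ xs) = (x ∷ []) ∷ map (x ∷_) (prefixes xs)

substrings : {A : Set} → List A → List (List A)
substrings []       = []
substrings (x ∷ xs) = prefixes (x ∷ xs) List.++ substrings xs

allᵇ : {A : Set} → (A → Bool) → List A → Bool
allᵇ p []       = true
allᵇ p (x ∷ xs) = p x ∧ allᵇ p xs

increasing : {m : ℕ} → List (Fin m) → Bool
increasing []           = true
increasing (x ∷ [])     = true
increasing (x ∷ y ∷ xs) = (toℕ x <ᵇ toℕ y) ∧ increasing (y ∷ xs)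

notIn : {m : ℕ} → Fin m → List (Fin m) → Bool
notIn x ys = allᵇ (λ y → not (toℕ x ≡ᵇ toℕ y)) ys

distinct : {m : ℕ} → List (Fin m) → Bool
distinct []       = true
distinct (x ∷ xs) = notIn x xs ∧ distinct xs

isPermutation : {L : ℕ} → Vec (Fin L) L → Bool
isPermutation w = distinct (toList w)

-- Callan permutations of [n+k]:  N = {1..n}  (toℕ < n),  K = {n+1..n+k}.

inN : (n : ℕ) {m : ℕ} → Fin m → Bool
inN n x = toℕ x <ᵇ n

inK : (n : ℕ) {m : ℕ} → Fin m → Bool
inK n x = n ≤ᵇ toℕ x

isCallan : (n k : ℕ) → Vec (Fin (n + k)) (n + k) → Bool
isCallan n k w =
  allᵇ (λ s → not (allᵇ (inN n) s ∨ allᵇ (inK n) s) ∨ increasing s)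
      (substrings (toList w))

Callan : (n k : ℕ) → Set
Callan n k = Σ (Vec (Fin (n + k)) (n + k)) (λ w → T (isPermutation w ∧ isCallan n k w))

allWords : (m L : ℕ) → List (Vec (Fin m) L)
allWords m zero    = [] ∷ []
allWords m (suc L) = concatMap (λ x → map (x ∷_) (allWords m L)) (allFin m)

descents : {m : ℕ} → List (Fin m) → ℕ
descents []           = 0
descents (x ∷ [])     = 0
descents (x ∷ y ∷ xs) = (if toℕ y <ᵇ toℕ x then 1 else 0) + descents (y ∷ xs)
  where open import Data.Bool using (if_then_else_)

ascRuns : {m : ℕ} → List (Fin m) → ℕ
ascRuns []       = 0
ascRuns (x ∷ xs) = suc (descents (x ∷ xs))

eulerian : ℕ → ℕ → ℕ
eulerian k j =
  length (filterᵇ (λ w → isPermutation w ∧ (ascRuns (toList w) ≡ᵇ j)) (allWords k k))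

stirling2 : ℕ → ℕ → ℕ
stirling2 zero    zero    = 1
stirling2 zero    (suc r) = 0
stirling2 (suc n) zero    = 0
stirling2 (suc n) (suc r) = stirling2 n r + suc r * stirling2 n (suc r)

callanSum : ℕ → ℕ → ℕ
callanSum n k =
  sumℕ k (λ j → eulerian k j *
    sumℕ (suc j) (λ m → ((suc j) C m) * ((m + (k ∸ j)) ! * stirling2 n (m + (k ∸ j)))))

-- Poly-Bernoulli numbers via formal power series over ℚ
-- (a formal power series is its coefficient sequence ℕ → ℚ).

PS : Set
PS = ℕ → ℚ

oneS : PS
oneS zero    = 1ℚ
oneS (suc _) = 0ℚ

_-S_ : PS → PS → PS
(f -S g) i = f i ℚ.- g i

_*S_ : PS → PS → PS
(f *S g) n = sumℚ n (λ i → f i ℚ.* g (n ∸ i))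

powS : PS → ℕ → PS
powS f zero    = oneS
powS f (suc m) = f *S powS f m

signℤ : ℕ → ℤ
signℤ zero          = + 1
signℤ (suc zero)    = -[1+ 0 ]
signℤ (suc (suc i)) = signℤ i

expNeg : PS
expNeg i = (signℤ i / (i !)) {{i !≢0}}

oneMinusExpNeg : PS
oneMinusExpNeg = oneS -S expNeg

-- Li_{-k}(z) = Σ_{i≥1} z^i / i^{-k} = Σ_{i≥1} i^k z^i   (as a series in z)
LiNeg : ℕ → PS
LiNeg k zero    = 0ℚ
LiNeg k (suc i) = (+ (suc i ^ k)) / 1

-- division by z of a series with zero constant term
divZ : PS → PS
divZ f j = f (suc j)

-- composition f(u(x)) for u with zero constant term
compose : PS → PS → PS
compose f u n = sumℚ n (λ j → f j ℚ.* powS u j n)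

-- B_n^{(-k)} = n! [x^n] Li_{-k}(1-e^{-x}) / (1-e^{-x})
polyBernoulli : ℕ → ℕ → ℚ
polyBernoulli n k = ((+ (n !)) / 1) ℚ.* compose (divZ (LiNeg k)) oneMinusExpNeg n

{-# OPTIONS --safe #-}
module Submission where

-- Both counts and the poly-Bernoulli number equal the trace pairing
-- Σ_i a_i b_i, where a_i and b_i are the coefficients of the binomial
-- C(y,i) in (1+y)^n and (1+y)^k.
--
-- Writing a word letter by letter, the number of completions depends only on
-- how many letters of each colour are unused and how many of those are larger
-- than the last letter.  Raising that last parameter turns a factor y into
-- 1+y, so the number of completions is the pairing of y^(a-p) (1+y)^p with
-- (1+z)^b.  The Eulerian sum obeys the same recursion with one colour, a
-- descent contributing the factor 1+t and an ascent t; under C(y,i) ↦ t^i the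
-- completions are the image of y^p (1+y)^(a-p).
--
-- For u = 1 - e^(-x) one has u′ = 1 - u, which gives
-- f_{j+1}(n+1) = (j+1) (f_j(n) - f_{j+1}(n)) for f_j(n) = n! [x^n] u^j.  Hence
-- Σ_j C(j,i) f_j(n) = a_i, and expanding (j+1)^k = Σ_i C(j,i) b_i finishes.

open import Defs
open import Algebra.Bundles using (Semiring; CommutativeMonoid; CommutativeRing)
open import Data.Nat using (ℕ; zero; suc)
open import Function using (_∘_)
open import Relation.Binary.PropositionalEquality
  using (_≡_; refl; sym; trans; cong; cong₂; subst; module ≡-Reasoning)

-- Since (1+y)^n has i! S(n+1,i+1) as its coefficient of C(y,i), with S the Stirling numbers of the
-- second kind, the pairing is the classical sum of i!² S(n+1,i+1) S(k+1,i+1). The recursion on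
-- words closes up because of the substitution y ↦ y+1: it turns y^a into (1+y)^a, and by Pascal's
-- rule it acts on coefficient sequences as 1 plus the left shift, which the pairing absorbs up to a
-- product of constant terms. The rest of the counting side is telescoping of products of powers of
-- y and 1+y. Telescoping produces differences; over ℕ these are avoided by keeping the subtracted
-- terms on the other side and cancelling at the end. The pairing is cut off at an arbitrary bound
-- `B` above the degrees, so that shifted sums lose no term and all evaluations can share one `B`.

module RangeSum {c ℓ} (R : Semiring c ℓ) where
  open import Data.Nat using (_+_; _<_)
  import Data.Nat.Properties as ℕₚ
  open Semiring R renaming (_+_ to _⊕_; _*_ to _⊛_; refl to ≈-refl; trans to ≈-trans; sym to ≈-sym)
  open import Relation.Binary.Reasoning.Setoid setoid
  open import Algebra.Properties.CommutativeSemigroup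
    (CommutativeMonoid.commutativeSemigroup +-commutativeMonoid) using (interchange)

  -- Finite sums over a semiring

  ∑ : ℕ → (ℕ → Carrier) → Carrier
  ∑ zero    f = 0#
  ∑ (suc n) f = ∑ n f ⊕ f n

  ∑-cong-< : ∀ n {f g} → (∀ i → i < n → f i ≈ g i) → ∑ n f ≈ ∑ n g
  ∑-cong-< zero    h = ≈-refl
  ∑-cong-< (suc n) h = +-cong (∑-cong-< n (λ i i<n → h i (ℕₚ.m<n⇒m<1+n i<n))) (h n (ℕₚ.n<1+n n))

  ∑-cong : ∀ n {f g} → (∀ i → f i ≈ g i) → ∑ n f ≈ ∑ n g
  ∑-cong n h = ∑-cong-< n (λ i _ → h i)

  ∑-zero : ∀ n {f} → (∀ i → f i ≈ 0#) → ∑ n f ≈ 0#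
  ∑-zero zero    h = ≈-refl
  ∑-zero (suc n) h = ≈-trans (+-cong (∑-zero n h) (h n)) (+-identityˡ 0#)

  ∑-+ : ∀ n f g → ∑ n (λ i → f i ⊕ g i) ≈ ∑ n f ⊕ ∑ n g
  ∑-+ zero    f g = ≈-sym (+-identityˡ 0#)
  ∑-+ (suc n) f g = begin
    ∑ n (λ i → f i ⊕ g i) ⊕ (f n ⊕ g n) ≈⟨ +-congʳ (∑-+ n f g) ⟩
    (∑ n f ⊕ ∑ n g) ⊕ (f n ⊕ g n)       ≈⟨ interchange _ _ _ _ ⟩
    (∑ n f ⊕ f n) ⊕ (∑ n g ⊕ g n)       ∎

  ∑-*ˡ : ∀ n a f → ∑ n (λ i → a ⊛ f i) ≈ a ⊛ ∑ n f
  ∑-*ˡ zero    a f = ≈-sym (zeroʳ a)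
  ∑-*ˡ (suc n) a f = ≈-trans (+-congʳ (∑-*ˡ n a f)) (≈-sym (distribˡ a _ _))

  ∑-*ʳ : ∀ n a f → ∑ n (λ i → f i ⊛ a) ≈ ∑ n f ⊛ a
  ∑-*ʳ zero    a f = ≈-sym (zeroˡ a)
  ∑-*ʳ (suc n) a f = ≈-trans (+-congʳ (∑-*ʳ n a f)) (≈-sym (distribʳ a _ _))

  ∑-swap : ∀ m n (f : ℕ → ℕ → Carrier) → ∑ m (λ i → ∑ n (λ j → f i j)) ≈ ∑ n (λ j → ∑ m (λ i → f i j))
  ∑-swap zero    n f = ≈-sym (∑-zero n (λ _ → ≈-refl))
  ∑-swap (suc m) n f = ≈-trans (+-congʳ (∑-swap m n f)) (≈-sym (∑-+ n _ _))

  ∑-front : ∀ n f → ∑ (suc n) f ≈ f 0 ⊕ ∑ n (f ∘ suc)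
  ∑-front zero    f = +-comm 0# (f 0)
  ∑-front (suc n) f = ≈-trans (+-congʳ (∑-front n f)) (+-assoc _ _ _)

  ∑-split : ∀ m n f → ∑ (m + n) f ≈ ∑ m f ⊕ ∑ n (λ i → f (m + i))
  ∑-split m zero    f = begin
    ∑ (m + 0) f ≡⟨ cong (λ r → ∑ r f) (ℕₚ.+-identityʳ m) ⟩
    ∑ m f       ≈⟨ +-identityʳ _ ⟨
    ∑ m f ⊕ 0#  ∎
  ∑-split m (suc n) f = begin
    ∑ (m + suc n) f                                 ≡⟨ cong (λ r → ∑ r f) (ℕₚ.+-suc m n) ⟩
    ∑ (m + n) f ⊕ f (m + n)                         ≈⟨ +-congʳ (∑-split m n f) ⟩
    (∑ m f ⊕ ∑ n (λ i → f (m + i))) ⊕ f (m + n)     ≈⟨ +-assoc _ _ _ ⟩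
    ∑ m f ⊕ (∑ n (λ i → f (m + i)) ⊕ f (m + n))     ∎

module Counting where
  open import Data.Bool using (Bool; true; false; _∧_; _∨_; not; T; if_then_else_)
  open import Data.Bool.Properties using (∧-assoc; ∧-comm; ∧-zeroʳ; ∧-identityʳ; not-involutive)
  open import Data.Empty using (⊥)
  open import Data.Fin using (Fin; zero; suc; toℕ)
  open import Data.Fin.Properties using (+↔⊎; 0↔⊥; 1↔⊤)
  open import Data.List using (List; []; _∷_; _++_; length; filterᵇ; concatMap; tabulate; map)
  open import Data.Nat
  open import Data.Nat.Combinatorics using (_C_; nCk+nC[k+1]≡[n+1]C[k+1]; k>n⇒nCk≡0)
  open import Data.Nat.Properties
  open import Data.Nat.Tactic.RingSolver using (solve-∀)
  open import Data.Product using (Σ; _×_; _,_; proj₁; proj₂)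
  open import Data.Sum using (_⊎_; inj₁; inj₂)
  open import Data.Sum.Function.Propositional using (_⊎-↔_)
  open import Data.Vec using (Vec; []; _∷_; toList; head)
  open import Data.Vec.Properties using (length-toList)
  open import Function using (id; case_of_)
  open import Function.Bundles using (_↔_; mk↔ₛ′)
  open import Function.Properties.Inverse using (↔-sym; ↔-trans)
  open import Algebra.Properties.Semiring.Sum +-*-semiring
    using (sum; sum-cong-≗; ∑-distrib-+; *-distribˡ-sum)
  open RangeSum +-*-semiring

  -- Indicators, finite subsets, and the rank of a letter from the top

  ⟦_⟧ : Bool → ℕ
  ⟦ b ⟧ = if b then 1 else 0

  ⟦∧⟧ : ∀ a b → ⟦ a ∧ b ⟧ ≡ ⟦ a ⟧ * ⟦ b ⟧
  ⟦∧⟧ true  b = sym (+-identityʳ ⟦ b ⟧)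
  ⟦∧⟧ false b = refl

  ⟦⟧-cond : ∀ b {u v} → (b ≡ true → u ≡ v) → ⟦ b ⟧ * u ≡ ⟦ b ⟧ * v
  ⟦⟧-cond true  h = cong (1 *_) (h refl)
  ⟦⟧-cond false h = refl

  count : ∀ {m} → (Fin m → Bool) → ℕ
  count R = sum (λ z → ⟦ R z ⟧)

  count-cong : ∀ {m} {R Q : Fin m → Bool} → (∀ z → R z ≡ Q z) → count R ≡ count Q
  count-cong h = sum-cong-≗ (λ z → cong ⟦_⟧ (h z))

  count-mono : ∀ {m} {R Q : Fin m → Bool} → (∀ z → R z ≡ true → Q z ≡ true) → count R ≤ count Q
  count-mono {zero}          h = z≤n
  count-mono {suc m} {R} {Q} h = +-mono-≤ (pt (R zero) (h zero)) (count-mono (λ z → h (suc z)))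
    where
    pt : ∀ a {b} → (a ≡ true → b ≡ true) → ⟦ a ⟧ ≤ ⟦ b ⟧
    pt false h = z≤n
    pt true  h rewrite h refl = ≤-refl

  _∖_ : ∀ {m} → (Fin m → Bool) → Fin m → Fin m → Bool
  (R ∖ y) z = R z ∧ not (toℕ y ≡ᵇ toℕ z)

  count-∖ : ∀ {m} (R : Fin m → Bool) y → ⟦ R y ⟧ + count (R ∖ y) ≡ count R
  count-∖ {suc m} R zero = cong₂ _+_ refl (cong₂ _+_ (cong ⟦_⟧ (∧-zeroʳ (R zero)))
    (count-cong (λ z → ∧-identityʳ (R (suc z)))))
  count-∖ {suc m} R (suc y) = begin
    r + (⟦ R zero ∧ true ⟧ + count ((R ∘ suc) ∖ y)) ≡⟨ cong (λ a → r + (⟦ a ⟧ + c)) (∧-identityʳ (R zero)) ⟩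
    r + (⟦ R zero ⟧ + c)   ≡⟨ +-assoc r _ c ⟨
    (r + ⟦ R zero ⟧) + c   ≡⟨ cong (_+ c) (+-comm r _) ⟩
    (⟦ R zero ⟧ + r) + c   ≡⟨ +-assoc ⟦ R zero ⟧ r c ⟩
    ⟦ R zero ⟧ + (r + c)   ≡⟨ cong (⟦ R zero ⟧ +_) (count-∖ (R ∘ suc) y) ⟩
    count R                ∎
    where
    open ≡-Reasoning
    r = ⟦ R (suc y) ⟧
    c = count ((R ∘ suc) ∖ y)

  above : ∀ {m} → (Fin m → Bool) → Fin m → ℕ
  above R y = count (λ z → R z ∧ (toℕ y <ᵇ toℕ z))

  -- `above R` is the rank from the top, so it maps the letters of `R` bijectively onto the numbers
  -- below `count R`. This is how the letters themselves disappear from the recursion and only their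
  -- ranks stay.
  sum-above : ∀ {m} (R : Fin m → Bool) ψ → sum (λ y → ⟦ R y ⟧ * ψ (above R y)) ≡ ∑ (count R) ψ
  sum-above {zero}  R ψ = refl
  sum-above {suc m} R ψ = begin
    ⟦ R zero ⟧ * ψ (above R zero) + sum (λ y → ⟦ R (suc y) ⟧ * ψ (above R (suc y)))
      ≡⟨ cong₂ _+_ (cong (λ r → ⟦ R zero ⟧ * ψ r) first)
           (sum-cong-≗ (λ y → cong (λ a → ⟦ R (suc y) ⟧ * ψ (⟦ a ⟧ + above (R ∘ suc) y)) (∧-zeroʳ (R zero)))) ⟩
    ⟦ R zero ⟧ * ψ c + sum (λ y → ⟦ R (suc y) ⟧ * ψ (above (R ∘ suc) y))
      ≡⟨ cong (⟦ R zero ⟧ * ψ c +_) (sum-above (R ∘ suc) ψ) ⟩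
    ⟦ R zero ⟧ * ψ c + ∑ c ψ
      ≡⟨ last (R zero) ⟩
    ∑ (count R) ψ ∎
    where
    open ≡-Reasoning
    c = count (R ∘ suc)
    first : above R zero ≡ c
    first = cong₂ _+_ (cong ⟦_⟧ (∧-zeroʳ (R zero))) (count-cong (λ z → ∧-identityʳ (R (suc z))))
    last : ∀ b → ⟦ b ⟧ * ψ c + ∑ c ψ ≡ ∑ (⟦ b ⟧ + c) ψ
    last true  = trans (cong (_+ ∑ c ψ) (+-identityʳ (ψ c))) (+-comm (ψ c) (∑ c ψ))
    last false = refl

  T⇒≡ : ∀ {b} → T b → b ≡ true
  T⇒≡ {true} _ = refl

  ≡⇒T : ∀ {b} → b ≡ true → T b
  ≡⇒T refl = _

  ∧-elim : ∀ a {b} → a ∧ b ≡ true → a ≡ true × b ≡ true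
  ∧-elim true h = refl , h

  <⇒<ᵇ≡ : ∀ i j → i < j → (i <ᵇ j) ≡ true
  <⇒<ᵇ≡ i j i<j = T⇒≡ (<⇒<ᵇ i<j)

  <ᵇ≡⇒< : ∀ i j → (i <ᵇ j) ≡ true → i < j
  <ᵇ≡⇒< i j h = <ᵇ⇒< i j (≡⇒T h)

  ≥⇒<ᵇ≡ : ∀ i j → j ≤ i → (i <ᵇ j) ≡ false
  ≥⇒<ᵇ≡ i j j≤i with i <ᵇ j in eq
  ... | false = refl
  ... | true  with () ← <⇒≱ (<ᵇ≡⇒< i j eq) j≤i

  <ᵇ≡⇒≥ : ∀ i j → (i <ᵇ j) ≡ false → j ≤ i
  <ᵇ≡⇒≥ i j eq = ≮⇒≥ λ i<j → case trans (sym eq) (<⇒<ᵇ≡ i j i<j) of λ ()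

  <⇒≢ᵇ : ∀ i j → i < j → not (i ≡ᵇ j) ≡ true
  <⇒≢ᵇ i j i<j with i ≡ᵇ j in eq
  ... | false = refl
  ... | true  with () ← <⇒≢ i<j (≡ᵇ⇒≡ i j (≡⇒T eq))

  -- Here `x` is the last letter written, already used up, and `y` in `R` is a candidate for the
  -- next one. If x < y, then `y` itself is counted above `x` but not above `y`, which makes the
  -- inequality of ranks strict; otherwise all that lies above `x` lies above `y`.
  above-<ᵇ : ∀ {m} (R : Fin m → Bool) x y → R y ≡ true →
             (toℕ x <ᵇ toℕ y) ≡ (above R y <ᵇ above R x)
  above-<ᵇ R x y Ry with toℕ x <ᵇ toℕ y in eq
  ... | true  = sym (<⇒<ᵇ≡ (above R y) (above R x) (begin-strict
    above R y                  ≤⟨ count-mono sub ⟩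
    count (R′ ∖ y)             <⟨ n<1+n _ ⟩
    suc (count (R′ ∖ y))       ≡⟨ cong (λ b → ⟦ b ⟧ + count (R′ ∖ y)) R′y ⟨
    ⟦ R′ y ⟧ + count (R′ ∖ y)  ≡⟨ count-∖ R′ y ⟩
    above R x                  ∎))
    where
    open ≤-Reasoning
    R′ : Fin _ → Bool
    R′ z = R z ∧ (toℕ x <ᵇ toℕ z)
    R′y : R′ y ≡ true
    R′y = cong₂ _∧_ Ry eq
    sub : ∀ z → R z ∧ (toℕ y <ᵇ toℕ z) ≡ true → (R′ ∖ y) z ≡ true
    sub z h with ∧-elim (R z) h
    ... | Rz , h′ = cong₂ _∧_
      (cong₂ _∧_ Rz (<⇒<ᵇ≡ (toℕ x) (toℕ z) (<-trans (<ᵇ≡⇒< (toℕ x) (toℕ y) eq) y<z)))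
      (<⇒≢ᵇ (toℕ y) (toℕ z) y<z)
      where y<z = <ᵇ≡⇒< (toℕ y) (toℕ z) h′
  ... | false = sym (≥⇒<ᵇ≡ (above R y) (above R x) (count-mono sub))
    where
    sub : ∀ z → R z ∧ (toℕ x <ᵇ toℕ z) ≡ true → R z ∧ (toℕ y <ᵇ toℕ z) ≡ true
    sub z h with ∧-elim (R z) h
    ... | Rz , x<z = cong₂ _∧_ Rz (<⇒<ᵇ≡ (toℕ y) (toℕ z)
      (≤-<-trans (<ᵇ≡⇒≥ (toℕ x) (toℕ y) eq) (<ᵇ≡⇒< (toℕ x) (toℕ z) x<z)))

  above-∖ : ∀ {m} (R : Fin m → Bool) y → above (R ∖ y) y ≡ above R y
  above-∖ R y = count-cong pt
    where
    pt : ∀ z → (R ∖ y) z ∧ (toℕ y <ᵇ toℕ z) ≡ R z ∧ (toℕ y <ᵇ toℕ z)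
    pt z with toℕ y <ᵇ toℕ z in eq
    ... | false = trans (∧-zeroʳ _) (sym (∧-zeroʳ _))
    ... | true  = cong (_∧ true) (trans
      (cong (R z ∧_) (<⇒≢ᵇ (toℕ y) (toℕ z) (<ᵇ≡⇒< (toℕ y) (toℕ z) eq))) (∧-identityʳ (R z)))

  above-cong : ∀ {m} {R Q : Fin m → Bool} y → (∀ z → R z ≡ Q z) → above R y ≡ above Q y
  above-cong y h = count-cong (λ z → cong (_∧ (toℕ y <ᵇ toℕ z)) (h z))

  -- Sums over words and the state recursion

  wsum : ∀ {m} L → (Vec (Fin m) L → ℕ) → ℕ
  wsum zero    φ = φ []
  wsum (suc L) φ = sum (λ x → wsum L (λ w → φ (x ∷ w)))

  wsum-cong : ∀ {m} L {φ ψ : Vec (Fin m) L → ℕ} → (∀ w → φ w ≡ ψ w) → wsum L φ ≡ wsum L ψ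
  wsum-cong zero    h = h []
  wsum-cong (suc L) h = sum-cong-≗ (λ x → wsum-cong L (λ w → h (x ∷ w)))

  wsum-+ : ∀ {m} L (φ ψ : Vec (Fin m) L → ℕ) → wsum L (λ w → φ w + ψ w) ≡ wsum L φ + wsum L ψ
  wsum-+ zero    φ ψ = refl
  wsum-+ {m} (suc L) φ ψ = trans (sum-cong-≗ {m} (λ x → wsum-+ L (λ w → φ (x ∷ w)) (λ w → ψ (x ∷ w))))
                                 (∑-distrib-+ {m} _ _)

  wsum-*ˡ : ∀ {m} L a (φ : Vec (Fin m) L → ℕ) → wsum L (λ w → a * φ w) ≡ a * wsum L φ
  wsum-*ˡ zero    a φ = refl
  wsum-*ˡ {m} (suc L) a φ = trans (sum-cong-≗ {m} (λ x → wsum-*ˡ L a (λ w → φ (x ∷ w))))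
                              (sym (*-distribˡ-sum {m} a _))

  -- The state of a partially written word: L letters to come, a unused letters
  -- of the colour of the last letter, p of them larger than it, and b unused
  -- letters of the other colour. The argument of g counts same-coloured
  -- neighbours that do not ascend.
  G : ℕ → ℕ → ℕ → ℕ → (ℕ → ℕ) → ℕ
  G zero    a b p g = g 0
  G (suc L) a b p g = ∑ a (λ p′ → G L (pred a) b p′ (if p′ <ᵇ p then g else g ∘ suc))
                    + ∑ b (λ q → G L (pred b) a q g)

  -- With L letters to come, the cost is at most L, so `g` is only read up to there. The bound is
  -- what allows the truncated difference `suc L ∸ j` to be rewritten in `G-bumps`.
  G-cong : ∀ L {a b p g h} → (∀ j → j ≤ L → g j ≡ h j) → G L a b p g ≡ G L a b p h
  G-cong zero    e = e 0 z≤n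
  G-cong (suc L) {a} {b} {p} {g} {h} e = cong₂ _+_
    (∑-cong a (λ p′ → G-cong L (pt (p′ <ᵇ p))))
    (∑-cong b (λ q → G-cong L (λ j j≤L → e j (m≤n⇒m≤1+n j≤L))))
    where
    pt : ∀ c j → j ≤ L → (if c then g else g ∘ suc) j ≡ (if c then h else h ∘ suc) j
    pt true  j j≤L = e j (m≤n⇒m≤1+n j≤L)
    pt false j j≤L = e (suc j) (s≤s j≤L)

  -- Equality of colours, in a form that computes to `d` or `not d` once the first argument is
  -- known; the two colour classes then reduce to a predicate and its negation.
  same : Bool → Bool → Bool
  same true  d = d
  same false d = not d

  same-refl : ∀ c → same c c ≡ true
  same-refl true  = refl
  same-refl false = refl

  same-not : ∀ c d → same (not c) d ≡ not (same c d)
  same-not true  d     = refl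
  same-not false true  = refl
  same-not false false = refl

  same⇒≡ : ∀ c {d} → same c d ≡ true → d ≡ c
  same⇒≡ true  h = h
  same⇒≡ false {false} h = refl

  -- From words over two colours to states

  module Words {m : ℕ} (col : Fin m → Bool) where

    step : Fin m → Fin m → ℕ
    step x y = ⟦ same (col x) (col y) ∧ not (toℕ x <ᵇ toℕ y) ⟧

    cost : Fin m → List (Fin m) → ℕ
    cost x []       = 0
    cost x (y ∷ ys) = step x y + cost y ys

    cost₀ : List (Fin m) → ℕ
    cost₀ []       = 0
    cost₀ (x ∷ xs) = cost x xs

    valid : (Fin m → Bool) → List (Fin m) → Bool
    valid R xs = allᵇ R xs ∧ distinct xs

    allᵇ-∧ : ∀ (p q : Fin m → Bool) xs → allᵇ (λ z → p z ∧ q z) xs ≡ allᵇ p xs ∧ allᵇ q xs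
    allᵇ-∧ p q []       = refl
    allᵇ-∧ p q (x ∷ xs) rewrite allᵇ-∧ p q xs = ∧-interchange (p x) (q x) (allᵇ p xs) (allᵇ q xs)
      where
      ∧-interchange : ∀ a b c d → (a ∧ b) ∧ (c ∧ d) ≡ (a ∧ c) ∧ (b ∧ d)
      ∧-interchange false b     c d = refl
      ∧-interchange true  true  c d = refl
      ∧-interchange true  false c d = sym (∧-zeroʳ c)

    valid-∷ : ∀ R y ys → valid R (y ∷ ys) ≡ R y ∧ valid (R ∖ y) ys
    valid-∷ R y ys = begin
      (R y ∧ allᵇ R ys) ∧ (notIn y ys ∧ distinct ys)  ≡⟨ ∧-assoc (R y) _ _ ⟩
      R y ∧ (allᵇ R ys ∧ (notIn y ys ∧ distinct ys))  ≡⟨ cong (R y ∧_) (∧-assoc (allᵇ R ys) _ _) ⟨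
      R y ∧ ((allᵇ R ys ∧ notIn y ys) ∧ distinct ys)
        ≡⟨ cong (λ b → R y ∧ (b ∧ distinct ys)) (allᵇ-∧ R _ ys) ⟨
      R y ∧ valid (R ∖ y) ys                          ∎
      where open ≡-Reasoning

    completions : (Fin m → Bool) → Fin m → ∀ L → (ℕ → ℕ) → ℕ
    completions R x L g = wsum L (λ w → ⟦ valid R (toList w) ⟧ * g (cost x (toList w)))

    -- The weight may depend on the first letter; this covers both the continuation after a given
    -- letter, where that letter decides the first cost, and the start of a word, where it does not.
    completions-suc : ∀ R L (h : Fin m → ℕ → ℕ) →
      wsum (suc L) (λ w → ⟦ valid R (toList w) ⟧ * (h (head w) (cost₀ (toList w))))
      ≡ sum (λ y → ⟦ R y ⟧ * completions (R ∖ y) y L (h y))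
    completions-suc R L h = sum-cong-≗ (λ y → trans (wsum-cong L (λ w → begin
      ⟦ valid R (y ∷ toList w) ⟧ * h y (cost y (toList w))
        ≡⟨ cong (λ b → ⟦ b ⟧ * h y (cost y (toList w))) (valid-∷ R y (toList w)) ⟩
      ⟦ R y ∧ valid (R ∖ y) (toList w) ⟧ * h y (cost y (toList w))
        ≡⟨ cong (_* h y (cost y (toList w))) (⟦∧⟧ (R y) _) ⟩
      ⟦ R y ⟧ * ⟦ valid (R ∖ y) (toList w) ⟧ * h y (cost y (toList w))
        ≡⟨ *-assoc ⟦ R y ⟧ _ _ ⟩
      ⟦ R y ⟧ * (⟦ valid (R ∖ y) (toList w) ⟧ * h y (cost y (toList w))) ∎))
      (wsum-*ˡ L ⟦ R y ⟧ _))
      where open ≡-Reasoning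

    class : Bool → (Fin m → Bool) → Fin m → Bool
    class c R z = R z ∧ same c (col z)

    class-∖ : ∀ c R y z → class c (R ∖ y) z ≡ (class c R ∖ y) z
    class-∖ c R y z = begin
      (R z ∧ e) ∧ s  ≡⟨ ∧-assoc (R z) e s ⟩
      R z ∧ (e ∧ s)  ≡⟨ cong (R z ∧_) (∧-comm e s) ⟩
      R z ∧ (s ∧ e)  ≡⟨ ∧-assoc (R z) s e ⟨
      (R z ∧ s) ∧ e  ∎
      where
      open ≡-Reasoning
      e = not (toℕ y ≡ᵇ toℕ z)
      s = same c (col z)

    count-class-∖-same : ∀ R y → R y ≡ true →
      count (class (col y) (R ∖ y)) ≡ pred (count (class (col y) R))
    count-class-∖-same R y Ry = trans (count-cong (class-∖ c R y)) (cong pred (begin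
      suc (count (class c R ∖ y))
        ≡⟨ cong (λ b → ⟦ b ⟧ + count (class c R ∖ y)) (cong₂ _∧_ Ry (same-refl c)) ⟨
      ⟦ class c R y ⟧ + count (class c R ∖ y) ≡⟨ count-∖ (class c R) y ⟩
      count (class c R)                       ∎))
      where
      open ≡-Reasoning
      c = col y

    count-class-∖-other : ∀ R y → count (class (not (col y)) (R ∖ y)) ≡ count (class (not (col y)) R)
    count-class-∖-other R y = trans (count-cong (class-∖ c R y)) (trans
      (cong (λ b → ⟦ b ⟧ + count (class c R ∖ y)) (sym ∉))
      (count-∖ (class c R) y))
      where
      c = not (col y)
      ∉ : class c R y ≡ false
      ∉ = trans (cong (R y ∧_) (trans (same-not (col y) (col y)) (cong not (same-refl (col y))))) (∧-zeroʳ (R y))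

    Transfer : ℕ → Set
    Transfer L = ∀ R x g → completions R x L g ≡
      G L (count (class (col x) R)) (count (class (not (col x)) R)) (above (class (col x) R) x) g

    sum-by-class : ∀ c R (f : Fin m → ℕ) →
      sum (λ y → ⟦ R y ⟧ * f y) ≡
      sum (λ y → ⟦ class c R y ⟧ * f y) + sum (λ y → ⟦ class (not c) R y ⟧ * f y)
    sum-by-class c R f = trans (sum-cong-≗ (λ y → trans (cong (_* f y) (split (R y) y)) (*-distribʳ-+ (f y) ⟦ class c R y ⟧ _)))
                               (∑-distrib-+ {m} _ _)
      where
      split : ∀ r y → ⟦ r ⟧ ≡ ⟦ r ∧ same c (col y) ⟧ + ⟦ r ∧ same (not c) (col y) ⟧
      split false y = refl
      split true  y rewrite same-not c (col y) with same c (col y)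
      ... | true  = refl
      ... | false = refl

    -- The colour `c` is a parameter rather than `col x`, and `h` is abstract, so that the same
    -- computation serves the inductive step and the first letter, which has no predecessor.
    -- Own-coloured letters may enter the weight through their rank only; a change of colour leaves
    -- `g` as it is.
    next-letter : ∀ L → Transfer L → ∀ R c g (θ : ℕ → ℕ → ℕ) (h : Fin m → ℕ → ℕ) →
      (∀ y → class c R y ≡ true → ∀ j → h y j ≡ θ (above (class c R) y) j) →
      (∀ y → class (not c) R y ≡ true → ∀ j → h y j ≡ g j) →
      sum (λ y → ⟦ R y ⟧ * completions (R ∖ y) y L (h y)) ≡
      ∑ (count (class c R)) (λ p → G L (pred (count (class c R))) (count (class (not c) R)) p (θ p))
      + ∑ (count (class (not c) R)) (λ q → G L (pred (count (class (not c) R))) (count (class c R)) q g)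
    next-letter L IH R c g θ h own other = begin
      sum (λ y → ⟦ R y ⟧ * completions (R ∖ y) y L (h y))
        ≡⟨ sum-by-class c R (λ y → completions (R ∖ y) y L (h y)) ⟩
      sum (λ y → ⟦ class c R y ⟧ * completions (R ∖ y) y L (h y))
        + sum (λ y → ⟦ class (not c) R y ⟧ * completions (R ∖ y) y L (h y))
        ≡⟨ cong₂ _+_ (sum-cong-≗ (λ y → ⟦⟧-cond (class c R y) (λ e → trans (eval y c e)
                        (G-cong L (λ j _ → own y e j)))))
                     (sum-cong-≗ (λ y → ⟦⟧-cond (class (not c) R y) (λ e → trans (eval y (not c) e)
                        (trans (G-cong L (λ j _ → other y e j))
                               (cong (λ d → G L (pred b) (count (class d R)) (above (class (not c) R) y) g)
                                     (not-involutive c)))))) ⟩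
      sum (λ y → ⟦ class c R y ⟧ * G L (pred a) b (above (class c R) y) (θ (above (class c R) y)))
        + sum (λ y → ⟦ class (not c) R y ⟧ * G L (pred b) a (above (class (not c) R) y) g)
        ≡⟨ cong₂ _+_ (sum-above (class c R) (λ p → G L (pred a) b p (θ p)))
                     (sum-above (class (not c) R) (λ q → G L (pred b) a q g)) ⟩
      ∑ a (λ p → G L (pred a) b p (θ p)) + ∑ b (λ q → G L (pred b) a q g) ∎
      where
      open ≡-Reasoning
      a = count (class c R)
      b = count (class (not c) R)
      eval : ∀ y d → class d R y ≡ true → completions (R ∖ y) y L (h y) ≡
        G L (pred (count (class d R))) (count (class (not d) R)) (above (class d R) y) (h y)
      eval y d e with ∧-elim (R y) e
      ... | Ry , sd with refl ← same⇒≡ d sd = trans (IH (R ∖ y) y (h y)) (begin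
        G L (count (class (col y) (R ∖ y))) (count (class (not (col y)) (R ∖ y))) (above (class (col y) (R ∖ y)) y) (h y)
          ≡⟨ cong₂ (λ u v → G L u v (above (class (col y) (R ∖ y)) y) (h y))
               (count-class-∖-same R y Ry) (count-class-∖-other R y) ⟩
        G L (pred (count (class (col y) R))) (count (class (not (col y)) R)) (above (class (col y) (R ∖ y)) y) (h y)
          ≡⟨ cong (λ r → G L (pred (count (class (col y) R))) (count (class (not (col y)) R)) r (h y))
               (trans (above-cong y (class-∖ (col y) R y)) (above-∖ (class (col y) R) y)) ⟩
        G L (pred (count (class (col y) R))) (count (class (not (col y)) R)) (above (class (col y) R) y) (h y) ∎)

    transfer : ∀ L → Transfer L
    transfer zero    R x g = +-identityʳ (g 0)
    transfer (suc L) R x g = trans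
      (completions-suc R L (λ y j → g (step x y + j)))
      (next-letter L (transfer L) R c g
        -- A smaller rank from the top is a larger letter, so the test recognises an ascent.
        (λ p → if p <ᵇ above (class c R) x then g else g ∘ suc)
        (λ y j → g (step x y + j)) own other)
      where
      c = col x
      own : ∀ y → class c R y ≡ true → ∀ j →
            g (step x y + j) ≡ (if above (class c R) y <ᵇ above (class c R) x then g else g ∘ suc) j
      own y e j with ∧-elim (R y) e | above-<ᵇ (class c R) x y e
      ... | _ , s | r rewrite s | sym r with toℕ x <ᵇ toℕ y
      ...   | true  = refl
      ...   | false = refl
      other : ∀ y → class (not c) R y ≡ true → ∀ j → g (step x y + j) ≡ g j
      other y e j with ∧-elim (R y) e
      ... | _ , s with same c (col y) | trans (sym (same-not c (col y))) s
      ...   | false | _ = refl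

    allowed : Bool → Fin m → Bool
    allowed c z = same c (col z)

    -- A word that has not begun has no last letter. Taking p = a imitates one of colour `true` that
    -- lies below all letters, so the first letter costs nothing whichever colour it has.
    perm-sum : ∀ L g → wsum L (λ w → ⟦ distinct (toList w) ⟧ * g (cost₀ (toList w))) ≡
      G L (count (allowed true)) (count (allowed false)) (count (allowed true)) g
    perm-sum zero    g = +-identityʳ (g 0)
    perm-sum (suc L) g = begin
      wsum (suc L) (λ w → ⟦ distinct (toList w) ⟧ * g (cost₀ (toList w)))
        ≡⟨ wsum-cong (suc L) (λ w → cong (λ b → ⟦ b ∧ distinct (toList w) ⟧ * g (cost₀ (toList w))) (sym (allᵇ-true (toList w)))) ⟩
      wsum (suc L) (λ w → ⟦ valid (λ _ → true) (toList w) ⟧ * g (cost₀ (toList w)))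
        ≡⟨ completions-suc (λ _ → true) L (λ _ → g) ⟩
      sum (λ y → ⟦ true ⟧ * completions ((λ _ → true) ∖ y) y L g)
        ≡⟨ next-letter L (transfer L) (λ _ → true) true g (λ _ → g) (λ _ → g) (λ _ _ _ → refl) (λ _ _ _ → refl) ⟩
      ∑ a (λ p → G L (pred a) b p g) + ∑ b (λ q → G L (pred b) a q g)
        ≡⟨ cong (_+ ∑ b (λ q → G L (pred b) a q g)) (∑-cong-< a (λ p p<a →
             cong (λ t → G L (pred a) b p (if t then g else g ∘ suc)) (sym (<⇒<ᵇ≡ p a p<a)))) ⟩
      G (suc L) a b a g ∎
      where
      open ≡-Reasoning
      a = count (allowed true)
      b = count (allowed false)
      allᵇ-true : ∀ xs → allᵇ {Fin m} (λ _ → true) xs ≡ true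
      allᵇ-true []       = refl
      allᵇ-true (x ∷ xs) = allᵇ-true xs

  -- Expansions in the binomial basis

  -- coeff p r i is the coefficient of C(y,i) in y^r (1+y)^p.
  coeff : ℕ → ℕ → ℕ → ℕ
  coeff zero    zero    zero    = 1
  coeff zero    zero    (suc i) = 0
  coeff zero    (suc r) zero    = 0
  coeff zero    (suc r) (suc i) = suc i * (coeff zero r (suc i) + coeff zero r i)
  coeff (suc p) r       i       = coeff p r i + coeff p (suc r) i

  -- The coefficients of y^r in the binomials count surjections; the recursion of `coeff` in r is
  -- the Stirling recursion scaled by factorials.
  coeff-stirling : ∀ r i → coeff 0 r i ≡ i ! * stirling2 r i
  coeff-stirling zero    zero    = refl
  coeff-stirling zero    (suc i) = sym (*-zeroʳ (suc i !))
  coeff-stirling (suc r) zero    = refl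
  coeff-stirling (suc r) (suc i) rewrite coeff-stirling r (suc i) | coeff-stirling r i =
    lem (suc i) (i !) (stirling2 r i) (stirling2 r (suc i))
    where
    lem : ∀ a f s t → a * (a * f * t + f * s) ≡ a * f * (s + a * t)
    lem = solve-∀

  coeff-y₀ : ∀ p r → coeff p (suc r) 0 ≡ 0
  coeff-y₀ zero    r = refl
  coeff-y₀ (suc p) r = cong₂ _+_ (coeff-y₀ p r) (coeff-y₀ p (suc r))

  -- The definition imposes y C(y,i) = i C(y,i) + (i+1) C(y,i+1) only at p = 0. Multiplication by
  -- 1+y is linear and commutes with multiplication by y, so the rule persists for all p.
  coeff-y : ∀ p r i → coeff p (suc r) (suc i) ≡ suc i * (coeff p r (suc i) + coeff p r i)
  coeff-y zero    r i = refl
  coeff-y (suc p) r i = trans (cong₂ _+_ (coeff-y p r i) (coeff-y p (suc r) i))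
    (lem (suc i) (coeff p r (suc i)) (coeff p r i) (coeff p (suc r) (suc i)) (coeff p (suc r) i))
    where
    lem : ∀ a s t u v → a * (s + t) + a * (u + v) ≡ a * (s + u + (t + v))
    lem = solve-∀

  coeff-1+y₀ : ∀ p r → coeff (suc p) r 0 ≡ coeff p r 0
  coeff-1+y₀ p r rewrite coeff-y₀ p r = +-identityʳ _

  coeff-1+y : ∀ p r i → coeff (suc p) r (suc i) ≡ suc (suc i) * coeff p r (suc i) + suc i * coeff p r i
  coeff-1+y p r i rewrite coeff-y p r i = lem (suc i) (coeff p r (suc i)) (coeff p r i)
    where
    lem : ∀ a s t → s + a * (s + t) ≡ s + a * s + a * t
    lem = solve-∀

  coeff-bound : ∀ p r i → p + r < i → coeff p r i ≡ 0
  coeff-bound zero    zero    (suc i) h = refl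
  coeff-bound zero    (suc r) (suc i) (s≤s h)
    rewrite coeff-bound zero r (suc i) (m<n⇒m<1+n h) | coeff-bound zero r i h = *-zeroʳ (suc i)
  coeff-bound (suc p) r i h = cong₂ _+_ (coeff-bound p r i (<-trans (n<1+n _) h))
                                    (coeff-bound p (suc r) i (≤-trans (s≤s (≤-reflexive (+-suc p r))) h))

  -- (1+y)^p arises from y^p by substituting y+1 for y, and C(y+1,i+1) = C(y,i+1) + C(y,i). The
  -- induction checks that both sides respond alike to one more factor.
  coeff-shift : ∀ p i → coeff p 0 i ≡ coeff 0 p i + coeff 0 p (suc i)
  coeff-shift zero zero    = refl
  coeff-shift zero (suc i) = refl
  coeff-shift (suc p) zero = begin
    coeff (suc p) 0 0                   ≡⟨ coeff-1+y₀ p 0 ⟩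
    coeff p 0 0                         ≡⟨ coeff-shift p 0 ⟩
    coeff 0 p 0 + coeff 0 p 1               ≡⟨ lem (coeff 0 p 0) (coeff 0 p 1) ⟩
    0 + 1 * (coeff 0 p 1 + coeff 0 p 0)     ∎
    where
    open ≡-Reasoning
    lem : ∀ s t → s + t ≡ 1 * (t + s)
    lem = solve-∀
  coeff-shift (suc p) (suc i) = begin
    coeff (suc p) 0 (suc i)                              ≡⟨ coeff-1+y p 0 i ⟩
    suc (suc i) * coeff p 0 (suc i) + suc i * coeff p 0 i
      ≡⟨ cong₂ (λ u v → suc (suc i) * u + suc i * v) (coeff-shift p (suc i)) (coeff-shift p i) ⟩
    suc (suc i) * (s + t) + suc i * (r + s)          ≡⟨ lem i r s t ⟩
    suc i * (s + r) + suc (suc i) * (t + s)          ∎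
    where
    open ≡-Reasoning
    r = coeff 0 p i
    s = coeff 0 p (suc i)
    t = coeff 0 p (suc (suc i))
    lem : ∀ i r s t → suc (suc i) * (s + t) + suc i * (r + s) ≡ suc i * (s + r) + suc (suc i) * (t + s)
    lem = solve-∀

  -- The truncated trace pairing

  pair : ℕ → (ℕ → ℕ) → (ℕ → ℕ) → ℕ
  pair B u v = ∑ B (λ i → u i * v i)

  pair-congˡ : ∀ B {u u′} v → (∀ i → u i ≡ u′ i) → pair B u v ≡ pair B u′ v
  pair-congˡ B v h = ∑-cong B (λ i → cong (_* v i) (h i))

  pair-congʳ : ∀ B u {v v′} → (∀ i → v i ≡ v′ i) → pair B u v ≡ pair B u v′
  pair-congʳ B u h = ∑-cong B (λ i → cong (u i *_) (h i))

  pair-comm : ∀ B u v → pair B u v ≡ pair B v u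
  pair-comm B u v = ∑-cong B (λ i → *-comm (u i) (v i))

  pair-+ˡ : ∀ B u u′ v → pair B (λ i → u i + u′ i) v ≡ pair B u v + pair B u′ v
  pair-+ˡ B u u′ v = trans (∑-cong B (λ i → *-distribʳ-+ (v i) (u i) (u′ i))) (∑-+ B _ _)

  pair-+ʳ : ∀ B u v v′ → pair B u (λ i → v i + v′ i) ≡ pair B u v + pair B u v′
  pair-+ʳ B u v v′ = trans (∑-cong B (λ i → *-distribˡ-+ (u i) (v i) (v′ i))) (∑-+ B _ _)

  pair-∑ : ∀ B n (u : ℕ → ℕ → ℕ) v → ∑ n (λ j → pair B (u j) v) ≡ pair B (λ i → ∑ n (λ j → u j i)) v
  pair-∑ B n u v = trans (∑-swap n B _) (∑-cong B (λ i → ∑-*ʳ n (v i) (λ j → u j i)))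

  ∑-telescope : ∀ B f → ∑ B (f ∘ suc) + f 0 ≡ ∑ B f + f B
  ∑-telescope B f = trans (+-comm _ (f 0)) (sym (∑-front B f))

  -- (y ↦ y+1) acts on the binomial basis by adding a shift, so this is
  -- y^a (1+z)^b + (1+y)^a z^b = (1+y)^a (1+z)^b under the trace pairing.
  inclusion-exclusion : ∀ B a b → 0 < a + b → a < B →
    pair B (coeff 0 a) (coeff b 0) + pair B (coeff a 0) (coeff 0 b) ≡ pair B (coeff a 0) (coeff b 0)
  inclusion-exclusion B a b pos a<B = begin
    pair B u (coeff b 0) + pair B (coeff a 0) v
      ≡⟨ cong₂ _+_ (pair-congʳ B u (coeff-shift b)) (pair-congˡ B v (coeff-shift a)) ⟩
    pair B u v⁺ + pair B u⁺ v
      ≡⟨ trans (cong₂ _+_ (pair-+ʳ B u v (v ∘ suc)) (pair-+ˡ B u (u ∘ suc) v)) (lem₁ (pair B u v) _ _) ⟩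
    pair B u v + (pair B u (v ∘ suc) + (pair B u v + pair B (u ∘ suc) v))
      ≡⟨ cong (_+ (pair B u (v ∘ suc) + (pair B u v + pair B (u ∘ suc) v))) tele ⟨
    pair B (u ∘ suc) (v ∘ suc) + (pair B u (v ∘ suc) + (pair B u v + pair B (u ∘ suc) v))
      ≡⟨ lem₂ (pair B u v) (pair B u (v ∘ suc)) (pair B (u ∘ suc) v) _ ⟩
    pair B u v + pair B (u ∘ suc) v + (pair B u (v ∘ suc) + pair B (u ∘ suc) (v ∘ suc))
      ≡⟨ cong₂ _+_ (pair-+ˡ B u (u ∘ suc) v) (pair-+ˡ B u (u ∘ suc) (v ∘ suc)) ⟨
    pair B u⁺ v + pair B u⁺ (v ∘ suc)
      ≡⟨ pair-+ʳ B u⁺ v (v ∘ suc) ⟨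
    pair B u⁺ v⁺
      ≡⟨ trans (pair-congˡ B (coeff b 0) (coeff-shift a)) (pair-congʳ B u⁺ (coeff-shift b)) ⟨
    pair B (coeff a 0) (coeff b 0) ∎
    where
    open ≡-Reasoning
    u v u⁺ v⁺ : ℕ → ℕ
    u = coeff 0 a
    v = coeff 0 b
    u⁺ i = u i + u (suc i)
    v⁺ i = v i + v (suc i)
    -- Shifting both sequences drops only the product of their constant terms, which vanishes once
    -- one of the exponents is positive.
    uv0 : ∀ a b → 0 < a + b → coeff 0 a 0 * coeff 0 b 0 ≡ 0
    uv0 (suc a) b       _ = refl
    uv0 zero    (suc b) _ = refl
    tele : pair B (u ∘ suc) (v ∘ suc) ≡ pair B u v
    tele = begin
      pair B (u ∘ suc) (v ∘ suc)                ≡⟨ +-identityʳ _ ⟨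
      pair B (u ∘ suc) (v ∘ suc) + 0            ≡⟨ cong (pair B (u ∘ suc) (v ∘ suc) +_) (uv0 a b pos) ⟨
      pair B (u ∘ suc) (v ∘ suc) + u 0 * v 0    ≡⟨ ∑-telescope B (λ i → u i * v i) ⟩
      pair B u v + u B * v B                    ≡⟨ cong (λ c → pair B u v + c * v B) (coeff-bound 0 a B a<B) ⟩
      pair B u v + 0                            ≡⟨ +-identityʳ _ ⟩
      pair B u v                                ∎
    lem₁ : ∀ p q r → p + q + (p + r) ≡ p + (q + (p + r))
    lem₁ = solve-∀
    lem₂ : ∀ p q r s → s + (q + (p + r)) ≡ p + r + (q + s)
    lem₂ = solve-∀

  -- Words in which neighbours of one colour always ascend

  -- y^(a-p) (1+y)^p
  coeff⁺ : ℕ → ℕ → ℕ → ℕ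
  coeff⁺ a p = coeff p (a ∸ p)

  coeff⁺-diag : ∀ a i → coeff⁺ a a i ≡ coeff a 0 i
  coeff⁺-diag a i = cong (λ r → coeff a r i) (n∸n≡0 a)

  coeff⁺-step : ∀ a p i → p ≤ a → coeff⁺ a p i + coeff⁺ (suc a) p i ≡ coeff⁺ (suc a) (suc p) i
  coeff⁺-step a p i p≤a rewrite +-∸-assoc 1 p≤a = refl

  -- A telescope: for m = y^(a-p) (1+y)^p, the difference (1+y) m - y m is m. The extra summand
  -- y^(a+1) is its lower end, moved to the left.
  ∑-coeff⁺ : ∀ a p i → p ≤ suc a → ∑ p (λ p′ → coeff⁺ a p′ i) + coeff 0 (suc a) i ≡ coeff⁺ (suc a) p i
  ∑-coeff⁺ a zero    i _         = refl
  ∑-coeff⁺ a (suc p) i (s≤s p≤a) = begin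
    ∑ p f + f p + z     ≡⟨ +-assoc (∑ p f) (f p) z ⟩
    ∑ p f + (f p + z)   ≡⟨ cong (∑ p f +_) (+-comm (f p) z) ⟩
    ∑ p f + (z + f p)   ≡⟨ +-assoc (∑ p f) z (f p) ⟨
    ∑ p f + z + f p     ≡⟨ cong (_+ f p) (∑-coeff⁺ a p i (m≤n⇒m≤1+n p≤a)) ⟩
    coeff⁺ (suc a) p i + f p ≡⟨ +-comm _ (f p) ⟩
    f p + coeff⁺ (suc a) p i ≡⟨ coeff⁺-step a p i p≤a ⟩
    coeff⁺ (suc a) (suc p) i ∎
    where
    open ≡-Reasoning
    f = λ p′ → coeff⁺ a p′ i
    z = coeff 0 (suc a) i

  ∑-pair-coeff⁺ : ∀ B a p v → p ≤ a →
    ∑ p (λ p′ → pair B (coeff⁺ (pred a) p′) v) + pair B (coeff 0 a) v ≡ pair B (coeff⁺ a p) v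
  ∑-pair-coeff⁺ B zero    zero v z≤n = refl
  ∑-pair-coeff⁺ B (suc a) p    v p≤a = begin
    ∑ p (λ p′ → pair B (coeff⁺ a p′) v) + pair B (coeff 0 (suc a)) v
      ≡⟨ cong (_+ pair B (coeff 0 (suc a)) v) (pair-∑ B p (coeff⁺ a) v) ⟩
    pair B (λ i → ∑ p (λ p′ → coeff⁺ a p′ i)) v + pair B (coeff 0 (suc a)) v
      ≡⟨ pair-+ˡ B (λ i → ∑ p (λ p′ → coeff⁺ a p′ i)) (coeff 0 (suc a)) v ⟨
    pair B (λ i → ∑ p (λ p′ → coeff⁺ a p′ i) + coeff 0 (suc a) i) v
      ≡⟨ pair-congˡ B v (λ i → ∑-coeff⁺ a p i p≤a) ⟩
    pair B (coeff⁺ (suc a) p) v ∎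
    where open ≡-Reasoning

  δ : ℕ → ℕ
  δ zero    = 1
  δ (suc _) = 0

  G-zero : ∀ L a b p g → (∀ j → g j ≡ 0) → G L a b p g ≡ 0
  G-zero zero    a b p g h = h 0
  G-zero (suc L) a b p g h = cong₂ _+_
    (∑-zero a (λ p′ → G-zero L (pred a) b p′ _ (pt (p′ <ᵇ p))))
    (∑-zero b (λ q → G-zero L (pred b) a q g h))
    where
    pt : ∀ c j → (if c then g else g ∘ suc) j ≡ 0
    pt true  j = h j
    pt false j = h (suc j)

  ∑-if : ∀ a p (f : Bool → ℕ → ℕ) → p ≤ a →
    ∑ a (λ p′ → f (p′ <ᵇ p) p′) ≡ ∑ p (f true) + ∑ (a ∸ p) (λ i → f false (p + i))
  ∑-if a p f p≤a = begin
    ∑ a h                                        ≡⟨ cong (λ r → ∑ r h) (m+[n∸m]≡n p≤a) ⟨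
    ∑ (p + (a ∸ p)) h                            ≡⟨ ∑-split p (a ∸ p) h ⟩
    ∑ p h + ∑ (a ∸ p) (λ i → h (p + i))          ≡⟨ cong₂ _+_
      (∑-cong-< p (λ i i<p → cong (λ c → f c i) (<⇒<ᵇ≡ i p i<p)))
      (∑-cong (a ∸ p) (λ i → cong (λ c → f c (p + i)) (≥⇒<ᵇ≡ (p + i) p (m≤m+n p i)))) ⟩
    ∑ p (f true) + ∑ (a ∸ p) (λ i → f false (p + i)) ∎
    where
    open ≡-Reasoning
    h = λ p′ → f (p′ <ᵇ p) p′

  -- The weight `δ` kills every non-ascent. The sum over the current colour telescopes to V - Z, and
  -- the sum over the other colour to the pairing of (1+y)^a with (1+z)^b, minus W. By
  -- `inclusion-exclusion` that pairing equals Z + W, so V is all that remains.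
  G-δ : ∀ B L a b p → L ≡ a + b → p ≤ a → a < B → b < B →
        G L a b p δ ≡ pair B (coeff⁺ a p) (coeff b 0)
  G-δ (suc B) zero    zero    zero p eq z≤n a<B b<B = sym (trans (∑-front B _) (cong suc (∑-zero B (λ _ → refl))))
  G-δ B       (suc L) a b p eq p≤a a<B b<B = begin
    ∑ a (λ p′ → G L (pred a) b p′ (if p′ <ᵇ p then δ else δ ∘ suc)) + ∑ b (λ q → G L (pred b) a q δ)
      ≡⟨ cong₂ _+_ (∑-if a p (λ c p′ → G L (pred a) b p′ (if c then δ else δ ∘ suc)) p≤a)
                   (∑-cong-< b (λ q → other q)) ⟩
    ∑ p (λ p′ → G L (pred a) b p′ δ) + ∑ (a ∸ p) (λ i → G L (pred a) b (p + i) (δ ∘ suc))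
      + ∑ b (λ q → pair B (coeff⁺ (pred b) q) (coeff a 0))
      ≡⟨ cong (_+ ∑ b (λ q → pair B (coeff⁺ (pred b) q) (coeff a 0))) (cong₂ _+_
           (∑-cong-< p (λ p′ → own p′))
           (∑-zero (a ∸ p) (λ i → G-zero L (pred a) b (p + i) (δ ∘ suc) (λ _ → refl)))) ⟩
    ∑ p (λ p′ → pair B (coeff⁺ (pred a) p′) (coeff b 0)) + 0 + ∑ b (λ q → pair B (coeff⁺ (pred b) q) (coeff a 0))
      ≡⟨ cong (_+ ∑ b (λ q → pair B (coeff⁺ (pred b) q) (coeff a 0))) (+-identityʳ _) ⟩
    P + Q
      ≡⟨ +-cancelʳ-≡ (Z + W) (P + Q) V (begin
           P + Q + (Z + W)
             ≡⟨ lem P Q Z W ⟩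
           (P + Z) + (Q + W)
             ≡⟨ cong₂ _+_ (∑-pair-coeff⁺ B a p (coeff b 0) p≤a) (∑-pair-coeff⁺ B b b (coeff a 0) ≤-refl) ⟩
           V + pair B (coeff⁺ b b) (coeff a 0)
             ≡⟨ cong (V +_) (trans (pair-congˡ B (coeff a 0) (coeff⁺-diag b)) (pair-comm B (coeff b 0) (coeff a 0))) ⟩
           V + pair B (coeff a 0) (coeff b 0)
             ≡⟨ cong (V +_) (inclusion-exclusion B a b (≤-trans (s≤s z≤n) (≤-reflexive eq)) a<B) ⟨
           V + (Z + pair B (coeff a 0) (coeff 0 b))
             ≡⟨ cong (λ w → V + (Z + w)) (pair-comm B (coeff a 0) (coeff 0 b)) ⟩
           V + (Z + W) ∎) ⟩
    V ∎
    where
    open ≡-Reasoning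
    P = ∑ p (λ p′ → pair B (coeff⁺ (pred a) p′) (coeff b 0))
    Q = ∑ b (λ q → pair B (coeff⁺ (pred b) q) (coeff a 0))
    Z = pair B (coeff 0 a) (coeff b 0)
    W = pair B (coeff 0 b) (coeff a 0)
    V = pair B (coeff⁺ a p) (coeff b 0)
    lem : ∀ p q z w → p + q + (z + w) ≡ p + z + (q + w)
    lem = solve-∀
    own : ∀ p′ → p′ < p → G L (pred a) b p′ δ ≡ pair B (coeff⁺ (pred a) p′) (coeff b 0)
    own p′ p′<p = go a eq (≤-trans p′<p p≤a) a<B
      where
      go : ∀ a → suc L ≡ a + b → p′ < a → a < B →
        G L (pred a) b p′ δ ≡ pair B (coeff⁺ (pred a) p′) (coeff b 0)
      go (suc a) e (s≤s h) a<B = G-δ B L a b p′ (suc-injective e) h (<-trans (n<1+n a) a<B) b<B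
    other : ∀ q → q < b → G L (pred b) a q δ ≡ pair B (coeff⁺ (pred b) q) (coeff a 0)
    other q = go b eq b<B
      where
      go : ∀ b → suc L ≡ a + b → b < B → q < b → G L (pred b) a q δ ≡ pair B (coeff⁺ (pred b) q) (coeff a 0)
      go (suc b) e b<B (s≤s h) = G-δ B L b a q (suc-injective (trans e (trans (+-suc a b) (cong suc (+-comm a b)))))
        h (<-trans (n<1+n b) b<B) a<B

  -- One colour: permutations weighted by ascents and descents

  bump : (ℕ → ℕ) → ℕ → ℕ
  bump s r = s r + s (suc r)

  -- With S the shift of sequences, bumps j s r = ((1+S)^j s) r; a sequence s is
  -- read as the linear functional t^r ↦ s r, which sends t^r (1+t)^j to bumps j s r.
  bumps : ℕ → (ℕ → ℕ) → ℕ → ℕ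
  bumps zero    s = s
  bumps (suc j) s = bumps j (bump s)

  bumps-∘suc : ∀ j s r → bumps j s (suc r) ≡ bumps j (s ∘ suc) r
  bumps-∘suc zero    s r = refl
  bumps-∘suc (suc j) s r = bumps-∘suc j (bump s) r

  -- y^p (1+y)^(a-p)
  coeff⁻ : ℕ → ℕ → ℕ → ℕ
  coeff⁻ a p = coeff (a ∸ p) p

  -- This telescope descends from (1+y)^(a+1): each summand is the loss incurred by replacing one
  -- factor 1+y by y.
  ∑-coeff⁻ : ∀ a p i → p ≤ suc a → ∑ p (λ p′ → coeff⁻ a p′ i) + coeff⁻ (suc a) p i ≡ coeff (suc a) 0 i
  ∑-coeff⁻ a zero    i _         = refl
  ∑-coeff⁻ a (suc p) i (s≤s p≤a) = begin
    ∑ p f + f p + coeff⁻ (suc a) (suc p) i    ≡⟨ +-assoc (∑ p f) (f p) _ ⟩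
    ∑ p f + (f p + coeff⁻ (suc a) (suc p) i)  ≡⟨ cong (λ r → ∑ p f + coeff r p i) (+-∸-assoc 1 p≤a) ⟨
    ∑ p f + coeff⁻ (suc a) p i                ≡⟨ ∑-coeff⁻ a p i (m≤n⇒m≤1+n p≤a) ⟩
    coeff (suc a) 0 i                         ∎
    where
    open ≡-Reasoning
    f = λ p′ → coeff⁻ a p′ i

  ∑-pair-coeff⁻ : ∀ B a p s → p ≤ suc a →
    ∑ p (λ p′ → pair B (coeff⁻ a p′) s) + pair B (coeff⁻ (suc a) p) s ≡ pair B (coeff (suc a) 0) s
  ∑-pair-coeff⁻ B a p s h = begin
    ∑ p (λ p′ → pair B (coeff⁻ a p′) s) + pair B (coeff⁻ (suc a) p) s
      ≡⟨ cong (_+ pair B (coeff⁻ (suc a) p) s) (pair-∑ B p (coeff⁻ a) s) ⟩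
    pair B (λ i → ∑ p (λ p′ → coeff⁻ a p′ i)) s + pair B (coeff⁻ (suc a) p) s
      ≡⟨ pair-+ˡ B (λ i → ∑ p (λ p′ → coeff⁻ a p′ i)) (coeff⁻ (suc a) p) s ⟨
    pair B (λ i → ∑ p (λ p′ → coeff⁻ a p′ i) + coeff⁻ (suc a) p i) s
      ≡⟨ pair-congˡ B s (λ i → ∑-coeff⁻ a p i h) ⟩
    pair B (coeff (suc a) 0) s ∎
    where open ≡-Reasoning

  coeff⁻-diag : ∀ a i → coeff⁻ a a i ≡ coeff 0 a i
  coeff⁻-diag a i = cong (λ r → coeff r a i) (n∸n≡0 a)

  -- Under C(y,i) ↦ t^i, substituting y+1 for y multiplies an image without constant term by
  -- (1+t)/t. Hence t times the image of (1+y)^(a+1) is 1+t times the image of y^(a+1).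
  pair-bump : ∀ B a s → suc a < B →
    pair B (coeff (suc a) 0) (s ∘ suc) ≡ pair B (coeff 0 (suc a)) s + pair B (coeff 0 (suc a)) (s ∘ suc)
  pair-bump B a s h = begin
    pair B (coeff (suc a) 0) (s ∘ suc)                     ≡⟨ pair-congˡ B (s ∘ suc) (coeff-shift (suc a)) ⟩
    pair B (λ i → z i + z (suc i)) (s ∘ suc)           ≡⟨ pair-+ˡ B z (z ∘ suc) (s ∘ suc) ⟩
    pair B z (s ∘ suc) + pair B (z ∘ suc) (s ∘ suc)    ≡⟨ +-comm (pair B z (s ∘ suc)) _ ⟩
    pair B (z ∘ suc) (s ∘ suc) + pair B z (s ∘ suc)    ≡⟨ cong (_+ pair B z (s ∘ suc)) tele ⟩
    pair B z s + pair B z (s ∘ suc)                    ∎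
    where
    open ≡-Reasoning
    z = coeff 0 (suc a)
    tele : pair B (z ∘ suc) (s ∘ suc) ≡ pair B z s
    tele = begin
      pair B (z ∘ suc) (s ∘ suc)       ≡⟨ +-identityʳ _ ⟨
      pair B (z ∘ suc) (s ∘ suc) + 0   ≡⟨ ∑-telescope B (λ i → z i * s i) ⟩
      pair B z s + z B * s B           ≡⟨ cong (λ c → pair B z s + c * s B) (coeff-bound 0 (suc a) B h) ⟩
      pair B z s + 0                   ≡⟨ +-identityʳ _ ⟩
      pair B z s                       ∎

  -- The induction needs every functional `s`, because an ascent replaces it by `s ∘ suc` (a factor
  -- t) and a descent by `bump s` (a factor 1+t). Let X, E, Z be the images of y^p (1+y)^(L+1-p),
  -- (1+y)^(L+1), y^(L+1). The ascents telescope to t (E - X), the descents to (1+t) (X - Z), and t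
  -- E = (1+t) Z by `pair-bump`, which leaves X.
  G-bumps : ∀ B L p s → p ≤ L → L < B → G L L 0 p (λ j → bumps j s (L ∸ j)) ≡ pair B (coeff⁻ L p) s
  G-bumps (suc B) zero    p s z≤n h = sym (trans (∑-front B _) (trans
    (cong (s 0 + 0 +_) (∑-zero B (λ _ → refl))) (trans (+-identityʳ (s 0 + 0)) (+-identityʳ (s 0)))))
  G-bumps B       (suc L) p s p≤L h = begin
    ∑ (suc L) (λ p′ → G L L 0 p′ (if p′ <ᵇ p then g else g ∘ suc)) + 0
      ≡⟨ +-identityʳ _ ⟩
    ∑ (suc L) (λ p′ → G L L 0 p′ (if p′ <ᵇ p then g else g ∘ suc))
      ≡⟨ ∑-cong-< (suc L) (λ p′ p′<L → pt p′ p′<L (p′ <ᵇ p)) ⟩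
    ∑ (suc L) (λ p′ → f (p′ <ᵇ p) p′)
      ≡⟨ ∑-if (suc L) p f p≤L ⟩
    ∑ p (f true) + ∑ (suc L ∸ p) (λ i → f false (p + i))
      ≡⟨ +-cancelʳ-≡ (X₁ + (Z₀ + Z₁)) _ X₀ (begin
           P₁ + R + (X₁ + (Z₀ + Z₁))
             ≡⟨ lem P₁ R X₁ (Z₀ + Z₁) ⟩
           (P₁ + X₁) + (R + (Z₀ + Z₁))
             ≡⟨ cong₂ _+_ (∑-pair-coeff⁻ B L p (s ∘ suc) p≤L) rest ⟩
           E₁ + (X₀ + X₁)
             ≡⟨ cong (_+ (X₀ + X₁)) (pair-bump B L s h) ⟩
           Z₀ + Z₁ + (X₀ + X₁)
             ≡⟨ lem′ (Z₀ + Z₁) X₀ X₁ ⟩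
           X₀ + (X₁ + (Z₀ + Z₁)) ∎) ⟩
    X₀ ∎
    where
    open ≡-Reasoning
    g : ℕ → ℕ
    g j = bumps j s (suc L ∸ j)
    f : Bool → ℕ → ℕ
    f c p′ = pair B (coeff⁻ L p′) (if c then s ∘ suc else bump s)
    P₁ = ∑ p (f true)
    R  = ∑ (suc L ∸ p) (λ i → f false (p + i))
    X₀ = pair B (coeff⁻ (suc L) p) s
    X₁ = pair B (coeff⁻ (suc L) p) (s ∘ suc)
    Z₀ = pair B (coeff 0 (suc L)) s
    Z₁ = pair B (coeff 0 (suc L)) (s ∘ suc)
    E₁ = pair B (coeff (suc L) 0) (s ∘ suc)
    lem : ∀ a b c d → a + b + (c + d) ≡ a + c + (b + d)
    lem = solve-∀
    lem′ : ∀ a b c → a + (b + c) ≡ b + (c + a)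
    lem′ = solve-∀
    pt : ∀ p′ → p′ < suc L → ∀ c → G L L 0 p′ (if c then g else g ∘ suc) ≡ f c p′
    pt p′ (s≤s p′≤L) true  = trans
      (G-cong L (λ j j≤L → trans (cong (bumps j s) (+-∸-assoc 1 j≤L)) (bumps-∘suc j s (L ∸ j))))
      (G-bumps B L p′ (s ∘ suc) p′≤L (<-trans (n<1+n L) h))
    pt p′ (s≤s p′≤L) false = G-bumps B L p′ (bump s) p′≤L (<-trans (n<1+n L) h)
    rest : R + (Z₀ + Z₁) ≡ X₀ + X₁
    -- The descents occupy the ranks from p on. Adding the ranks below p to both sides turns each
    -- into a telescope that starts at rank 0.
    rest = +-cancelˡ-≡ (∑ p (f false)) _ _ (begin
      ∑ p (f false) + (R + (Z₀ + Z₁))     ≡⟨ +-assoc (∑ p (f false)) R _ ⟨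
      ∑ p (f false) + R + (Z₀ + Z₁)       ≡⟨ cong₂ _+_ join (sym (pair-+ʳ B (coeff 0 (suc L)) s (s ∘ suc))) ⟩
      ∑ (suc L) (f false) + pair B (coeff 0 (suc L)) (bump s)
        ≡⟨ cong (∑ (suc L) (f false) +_) (pair-congˡ B (bump s) (coeff⁻-diag (suc L))) ⟨
      ∑ (suc L) (f false) + pair B (coeff⁻ (suc L) (suc L)) (bump s)
        ≡⟨ ∑-pair-coeff⁻ B L (suc L) (bump s) ≤-refl ⟩
      pair B (coeff (suc L) 0) (bump s)
        ≡⟨ ∑-pair-coeff⁻ B L p (bump s) p≤L ⟨
      ∑ p (f false) + pair B (coeff⁻ (suc L) p) (bump s)
        ≡⟨ cong (∑ p (f false) +_) (pair-+ʳ B (coeff⁻ (suc L) p) s (s ∘ suc)) ⟩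
      ∑ p (f false) + (X₀ + X₁) ∎)
      where
      join : ∑ p (f false) + R ≡ ∑ (suc L) (f false)
      join = trans (sym (∑-split p (suc L ∸ p) (f false))) (cong (λ r → ∑ r (f false)) (m+[n∸m]≡n p≤L))

  -- The first letter is neither an ascent nor a descent, so the exponents of t and 1+t add up to
  -- k-1 only. With E and Z the images of (1+y)^k and y^k, the telescope yields (1+t) (E - Z), and
  -- (1+t) Z = t E reduces this to E. One of the two bumps is thereby used up; the other turns y^n
  -- into (1+y)^n by `coeff-shift`.
  G-bumps-start : ∀ B n k → 0 < k → k < B →
    G k k 0 k (λ d → bumps d (bump (bump (coeff 0 n))) (pred k ∸ d)) ≡ pair B (coeff k 0) (coeff n 0)
  G-bumps-start B n (suc k) _ h = begin
    ∑ (suc k) (λ p → G k k 0 p (if p <ᵇ suc k then g else g ∘ suc)) + 0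
      ≡⟨ +-identityʳ _ ⟩
    ∑ (suc k) (λ p → G k k 0 p (if p <ᵇ suc k then g else g ∘ suc))
      ≡⟨ ∑-cong-< (suc k) pt ⟩
    ∑ (suc k) (λ p → pair B (coeff⁻ k p) (bump σ))
      ≡⟨ +-cancelʳ-≡ (pair B z σ + pair B z (σ ∘ suc)) _ _ (begin
        ∑ (suc k) (λ p → pair B (coeff⁻ k p) (bump σ)) + (pair B z σ + pair B z (σ ∘ suc))
          ≡⟨ cong (∑ (suc k) (λ p → pair B (coeff⁻ k p) (bump σ)) +_)
               (trans (pair-congˡ B (bump σ) (coeff⁻-diag (suc k))) (pair-+ʳ B z σ (σ ∘ suc))) ⟨
        ∑ (suc k) (λ p → pair B (coeff⁻ k p) (bump σ)) + pair B (coeff⁻ (suc k) (suc k)) (bump σ)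
          ≡⟨ ∑-pair-coeff⁻ B k (suc k) (bump σ) ≤-refl ⟩
        pair B (coeff (suc k) 0) (bump σ)
          ≡⟨ pair-+ʳ B (coeff (suc k) 0) σ (σ ∘ suc) ⟩
        pair B (coeff (suc k) 0) σ + pair B (coeff (suc k) 0) (σ ∘ suc)
          ≡⟨ cong (pair B (coeff (suc k) 0) σ +_) (pair-bump B k σ h) ⟩
        pair B (coeff (suc k) 0) σ + (pair B z σ + pair B z (σ ∘ suc)) ∎) ⟩
    pair B (coeff (suc k) 0) σ
      ≡⟨ pair-congʳ B (coeff (suc k) 0) (coeff-shift n) ⟨
    pair B (coeff (suc k) 0) (coeff n 0) ∎
    where
    open ≡-Reasoning
    σ = bump (coeff 0 n)
    z = coeff 0 (suc k)
    g : ℕ → ℕ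
    g d = bumps d (bump σ) (k ∸ d)
    pt : ∀ p → p < suc k → G k k 0 p (if p <ᵇ suc k then g else g ∘ suc) ≡ pair B (coeff⁻ k p) (bump σ)
    pt p p<k rewrite <⇒<ᵇ≡ p (suc k) p<k = G-bumps B k p (bump σ) (s≤s⁻¹ p<k) (<-trans (n<1+n k) h)

  -- Binomial sums as iterated bumps

  sumℕ-∑ : ∀ n f → sumℕ n f ≡ ∑ (suc n) f
  sumℕ-∑ zero    f = refl
  sumℕ-∑ (suc n) f = cong (_+ f (suc n)) (sumℕ-∑ n f)

  -- The binomial theorem for (1+S)^b, where Pascal's rule peels off one bump at a time.
  ∑-binomial : ∀ b s r → ∑ (suc b) (λ m → (b C m) * s (m + r)) ≡ bumps b s r
  ∑-binomial zero    s r = +-identityʳ (s r)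
  ∑-binomial (suc b) s r = begin
    ∑ (suc (suc b)) (λ m → (suc b C m) * s (m + r))
      ≡⟨ ∑-front (suc b) _ ⟩
    s r + 0 + ∑ (suc b) (λ m → (suc b C suc m) * s (suc m + r))
      ≡⟨ cong (s r + 0 +_) (trans (∑-cong (suc b) (λ m → trans
           (cong (_* s (suc m + r)) (sym (nCk+nC[k+1]≡[n+1]C[k+1] b m)))
           (*-distribʳ-+ (s (suc m + r)) (b C m) (b C suc m)))) (∑-+ (suc b) _ _)) ⟩
    s r + 0 + (S₁ + ∑ (suc b) (λ m → (b C suc m) * s (suc m + r)))
      ≡⟨ lem (s r + 0) _ _ ⟩
    s r + 0 + ∑ (suc b) (λ m → (b C suc m) * s (suc m + r)) + S₁
      ≡⟨ cong (_+ S₁) (∑-front (suc b) (λ m → (b C m) * s (m + r))) ⟨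
    S₀ + (b C suc b) * s (suc b + r) + S₁
      ≡⟨ cong (λ c → S₀ + c * s (suc b + r) + S₁)
           (k>n⇒nCk≡0 (n<1+n b)) ⟩
    S₀ + 0 + S₁
      ≡⟨ cong (_+ S₁) (+-identityʳ S₀) ⟩
    S₀ + S₁
      ≡⟨ ∑-+ (suc b) _ _ ⟨
    ∑ (suc b) (λ m → (b C m) * s (m + r) + (b C m) * s (suc m + r))
      ≡⟨ ∑-cong (suc b) (λ m → *-distribˡ-+ (b C m) (s (m + r)) (s (suc m + r))) ⟨
    ∑ (suc b) (λ m → (b C m) * bump s (m + r))
      ≡⟨ ∑-binomial b (bump s) r ⟩
    bumps b (bump s) r ∎
    where
    open ≡-Reasoning
    S₀ = ∑ (suc b) (λ m → (b C m) * s (m + r))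
    S₁ = ∑ (suc b) (λ m → (b C m) * s (suc m + r))
    lem : ∀ u v w → u + (v + w) ≡ u + w + v
    lem = solve-∀

  -- Cardinalities of sets and lists of words

  private variable A : Set

  Σ-Fin-suc : ∀ {m} {P : Fin (suc m) → Set} → Σ (Fin (suc m)) P ↔ (P zero ⊎ Σ (Fin m) (P ∘ suc))
  Σ-Fin-suc = mk↔ₛ′
    (λ { (zero , p) → inj₁ p ; (suc i , p) → inj₂ (i , p) })
    (λ { (inj₁ p) → zero , p ; (inj₂ (i , p)) → suc i , p })
    (λ { (inj₁ p) → refl ; (inj₂ (i , p)) → refl })
    (λ { (zero , p) → refl ; (suc i , p) → refl })

  Σ-Fin : ∀ {m} {P : Fin m → Set} (f : Fin m → ℕ) → (∀ i → P i ↔ Fin (f i)) → Σ (Fin m) P ↔ Fin (sum f)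
  Σ-Fin {zero}  f h = mk↔ₛ′ (λ ()) (λ ()) (λ ()) (λ ())
  Σ-Fin {suc m} f h = ↔-trans Σ-Fin-suc (↔-trans (h zero ⊎-↔ Σ-Fin (f ∘ suc) (h ∘ suc)) (↔-sym +↔⊎))

  T-Fin : ∀ b → T b ↔ Fin ⟦ b ⟧
  T-Fin true  = ↔-sym 1↔⊤
  T-Fin false = ↔-sym 0↔⊥

  Vec-[] : ∀ {P : Vec A 0 → Set} → Σ (Vec A 0) P ↔ P []
  Vec-[] = mk↔ₛ′ (λ { ([] , p) → p }) ([] ,_) (λ _ → refl) (λ { ([] , p) → refl })

  Vec-∷ : ∀ {L} {P : Vec A (suc L) → Set} → Σ (Vec A (suc L)) P ↔ Σ A (λ a → Σ (Vec A L) (λ w → P (a ∷ w)))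
  Vec-∷ = mk↔ₛ′ (λ { (a ∷ w , p) → a , w , p }) (λ { (a , w , p) → a ∷ w , p })
                (λ _ → refl) (λ { (a ∷ w , p) → refl })

  -- The proof component `T (P w)` is a unit or empty, so each admissible word contributes exactly
  -- one element; the bijection follows the word letter by letter.
  words-↔ : ∀ {m} L (P : Vec (Fin m) L → Bool) →
    Σ (Vec (Fin m) L) (λ w → T (P w)) ↔ Fin (wsum L (λ w → ⟦ P w ⟧))
  words-↔ zero    P = ↔-trans Vec-[] (T-Fin (P []))
  words-↔ (suc L) P = ↔-trans Vec-∷ (Σ-Fin _ (λ a → words-↔ L (λ w → P (a ∷ w))))

  countᵇ : (A → Bool) → List A → ℕ
  countᵇ P xs = length (filterᵇ P xs)

  countᵇ-∷ : ∀ (P : A → Bool) a xs → countᵇ P (a ∷ xs) ≡ ⟦ P a ⟧ + countᵇ P xs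
  countᵇ-∷ P a xs with P a
  ... | true  = refl
  ... | false = refl

  countᵇ-++ : ∀ (P : A → Bool) xs ys → countᵇ P (xs ++ ys) ≡ countᵇ P xs + countᵇ P ys
  countᵇ-++ P []       ys = refl
  countᵇ-++ P (a ∷ xs) ys = begin
    countᵇ P (a ∷ xs ++ ys)                ≡⟨ countᵇ-∷ P a (xs ++ ys) ⟩
    ⟦ P a ⟧ + countᵇ P (xs ++ ys)          ≡⟨ cong (⟦ P a ⟧ +_) (countᵇ-++ P xs ys) ⟩
    ⟦ P a ⟧ + (countᵇ P xs + countᵇ P ys)  ≡⟨ +-assoc ⟦ P a ⟧ _ _ ⟨
    ⟦ P a ⟧ + countᵇ P xs + countᵇ P ys    ≡⟨ cong (_+ countᵇ P ys) (countᵇ-∷ P a xs) ⟨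
    countᵇ P (a ∷ xs) + countᵇ P ys        ∎
    where open ≡-Reasoning

  countᵇ-map : ∀ {B : Set} (P : B → Bool) (f : A → B) xs → countᵇ P (map f xs) ≡ countᵇ (P ∘ f) xs
  countᵇ-map P f []       = refl
  countᵇ-map P f (a ∷ xs) = trans (countᵇ-∷ P (f a) (map f xs))
    (trans (cong (⟦ P (f a) ⟧ +_) (countᵇ-map P f xs)) (sym (countᵇ-∷ (P ∘ f) a xs)))

  countᵇ-concatMap-tabulate : ∀ {B : Set} {m} (P : B → Bool) (f : A → List B) (g : Fin m → A) →
    countᵇ P (concatMap f (tabulate g)) ≡ sum (λ i → countᵇ P (f (g i)))
  countᵇ-concatMap-tabulate {m = zero}  P f g = refl
  countᵇ-concatMap-tabulate {m = suc m} P f g = trans (countᵇ-++ P (f (g zero)) _)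
    (cong (countᵇ P (f (g zero)) +_) (countᵇ-concatMap-tabulate P f (g ∘ suc)))

  countᵇ-allWords : ∀ m L (P : Vec (Fin m) L → Bool) → countᵇ P (allWords m L) ≡ wsum L (λ w → ⟦ P w ⟧)
  countᵇ-allWords m zero    P = trans (countᵇ-∷ P [] []) (+-identityʳ _)
  countᵇ-allWords m (suc L) P = trans
    (countᵇ-concatMap-tabulate P (λ a → map (a ∷_) (allWords m L)) id)
    (sum-cong-≗ (λ a → trans (countᵇ-map P (a ∷_) (allWords m L)) (countᵇ-allWords m L (λ w → P (a ∷ w)))))

  -- The Eulerian sum as a sum over permutations

  wsum-∑ : ∀ {m} L n (φ : ℕ → Vec (Fin m) L → ℕ) →
    ∑ n (λ j → wsum L (φ j)) ≡ wsum L (λ w → ∑ n (λ j → φ j w))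
  wsum-∑ L zero    φ = sym (wsum-*ˡ L 0 (λ _ → 0))
  wsum-∑ L (suc n) φ = trans (cong (_+ wsum L (φ n)) (wsum-∑ L n φ)) (sym (wsum-+ L _ (φ n)))

  ≡ᵇ-refl : ∀ r → (r ≡ᵇ r) ≡ true
  ≡ᵇ-refl r = T⇒≡ (≡⇒≡ᵇ r r refl)

  ≢⇒≡ᵇ : ∀ r j → (r ≡ j → ⊥) → (r ≡ᵇ j) ≡ false
  ≢⇒≡ᵇ r j h with r ≡ᵇ j in eq
  ... | false = refl
  ... | true  with () ← h (≡ᵇ⇒≡ r j (≡⇒T eq))

  ∑-select : ∀ n r (γ : ℕ → ℕ) → r < n → ∑ n (λ j → ⟦ r ≡ᵇ j ⟧ * γ j) ≡ γ r
  ∑-select (suc n) r γ (s≤s r≤n) with m≤n⇒m<n∨m≡n r≤n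
  ... | inj₁ r<n rewrite ≢⇒≡ᵇ r n (<⇒≢ r<n) = trans (+-identityʳ _) (∑-select n r γ r<n)
  ... | inj₂ refl rewrite ≡ᵇ-refl r | +-identityʳ (γ r) = cong (_+ γ r)
    (trans (∑-cong-< n (λ j j<r → cong (λ b → ⟦ b ⟧ * γ j) (≢⇒≡ᵇ r j (λ e → <⇒≢ j<r (sym e)))))
           (∑-zero n (λ _ → refl)))

  ascRuns≤length : ∀ {m} (xs : List (Fin m)) → ascRuns xs ≤ length xs
  ascRuns≤length []           = z≤n
  ascRuns≤length (a ∷ [])     = s≤s z≤n
  ascRuns≤length (a ∷ b ∷ xs) with toℕ b <ᵇ toℕ a | ascRuns≤length (b ∷ xs)
  ... | true  | h = s≤s h
  ... | false | h = m≤n⇒m≤1+n h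

  -- Permutations are sorted by their number of ascending runs. That number is at most the length k,
  -- so stopping the sum at k misses none.
  sum-eulerian : ∀ k (γ : ℕ → ℕ) →
    sumℕ k (λ j → eulerian k j * γ j) ≡ wsum k (λ w → ⟦ distinct (toList w) ⟧ * γ (ascRuns (toList w)))
  sum-eulerian k γ = begin
    sumℕ k (λ j → eulerian k j * γ j)
      ≡⟨ sumℕ-∑ k _ ⟩
    ∑ (suc k) (λ j → eulerian k j * γ j)
      ≡⟨ ∑-cong (suc k) (λ j → trans (*-comm (eulerian k j) (γ j)) (trans
           (cong (γ j *_) (countᵇ-allWords k k (P j))) (sym (wsum-*ˡ k (γ j) (λ w → ⟦ P j w ⟧))))) ⟩
    ∑ (suc k) (λ j → wsum k (λ w → γ j * ⟦ P j w ⟧))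
      ≡⟨ wsum-∑ k (suc k) (λ j w → γ j * ⟦ P j w ⟧) ⟩
    wsum k (λ w → ∑ (suc k) (λ j → γ j * ⟦ P j w ⟧))
      ≡⟨ wsum-cong k pt ⟩
    wsum k (λ w → ⟦ distinct (toList w) ⟧ * γ (ascRuns (toList w))) ∎
    where
    open ≡-Reasoning
    P : ℕ → Vec (Fin k) k → Bool
    P j w = isPermutation w ∧ (ascRuns (toList w) ≡ᵇ j)
    pt : ∀ w → ∑ (suc k) (λ j → γ j * ⟦ P j w ⟧) ≡ ⟦ distinct (toList w) ⟧ * γ (ascRuns (toList w))
    pt w = begin
      ∑ (suc k) (λ j → γ j * ⟦ d ∧ (r ≡ᵇ j) ⟧)
        ≡⟨ ∑-cong (suc k) (λ j → trans (*-comm (γ j) _) (trans (cong (_* γ j) (⟦∧⟧ d (r ≡ᵇ j))) (*-assoc ⟦ d ⟧ _ (γ j)))) ⟩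
      ∑ (suc k) (λ j → ⟦ d ⟧ * (⟦ r ≡ᵇ j ⟧ * γ j))
        ≡⟨ ∑-*ˡ (suc k) ⟦ d ⟧ _ ⟩
      ⟦ d ⟧ * ∑ (suc k) (λ j → ⟦ r ≡ᵇ j ⟧ * γ j)
        ≡⟨ cong (⟦ d ⟧ *_) (∑-select (suc k) r γ (s≤s (≤-trans (ascRuns≤length (toList w)) (≤-reflexive (length-toList w))))) ⟩
      ⟦ d ⟧ * γ r ∎
      where
      d = distinct (toList w)
      r = ascRuns (toList w)

  ≢ᵇ⇒>ᵇ : ∀ i j → not (i ≡ᵇ j) ≡ true → (j <ᵇ i) ≡ not (i <ᵇ j)
  ≢ᵇ⇒>ᵇ zero    (suc j) h = refl
  ≢ᵇ⇒>ᵇ (suc i) zero    h = refl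
  ≢ᵇ⇒>ᵇ (suc i) (suc j) h = ≢ᵇ⇒>ᵇ i j h

  module Eulerian (k : ℕ) where
    open Words {k} (λ _ → true)

    -- A descent tests y < x, whereas the cost tests the failure of x < y. The two differ only for
    -- equal neighbours, which distinctness excludes.
    descents-cost : ∀ a xs → distinct (a ∷ xs) ≡ true → descents (a ∷ xs) ≡ cost a xs
    descents-cost a []       h = refl
    descents-cost a (b ∷ xs) h with ∧-elim (not (toℕ a ≡ᵇ toℕ b) ∧ notIn a xs) h
    ... | h₁ , h₂ = cong₂ _+_ (cong ⟦_⟧ (≢ᵇ⇒>ᵇ (toℕ a) (toℕ b) (proj₁ (∧-elim _ h₁)))) (descents-cost b xs h₂)

    count-all : ∀ m → count {m} (λ _ → true) ≡ m
    count-all zero    = refl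
    count-all (suc m) = cong suc (count-all m)

    count-none : ∀ m → count {m} (λ _ → false) ≡ 0
    count-none zero    = refl
    count-none (suc m) = count-none m

    -- A nonempty word has one more run than it has descents, whence `γ ∘ suc` and the positivity of
    -- k.
    sum-over-permutations : 0 < k → ∀ γ →
      wsum k (λ w → ⟦ distinct (toList w) ⟧ * γ (ascRuns (toList w))) ≡ G k k 0 k (γ ∘ suc)
    sum-over-permutations 0<k γ = trans
      (wsum-cong k (λ w → ⟦⟧-cond (distinct (toList w)) (λ d → cong γ (runs (toList w) d (≤-trans 0<k (≤-reflexive (sym (length-toList w))))))))
      (trans (perm-sum k (γ ∘ suc))
             (cong₂ (λ a b → G k a b a (γ ∘ suc)) (count-all k) (count-none k)))
      where
      runs : ∀ xs → distinct xs ≡ true → 0 < length xs → ascRuns xs ≡ suc (cost₀ xs)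
      runs (a ∷ xs) d _ = cong suc (descents-cost a xs d)

  callanSum-pair : ∀ B n k → 0 < k → k < B → callanSum n k ≡ pair B (coeff k 0) (coeff n 0)
  callanSum-pair B n k 0<k k<B = begin
    callanSum n k
      ≡⟨ sum-eulerian k γ ⟩
    wsum k (λ w → ⟦ distinct (toList w) ⟧ * γ (ascRuns (toList w)))
      ≡⟨ Eulerian.sum-over-permutations k 0<k γ ⟩
    G k k 0 k (γ ∘ suc)
      ≡⟨ G-cong k (λ d _ → γ-bumps d) ⟩
    G k k 0 k (λ d → bumps d (bump (bump (coeff 0 n))) (pred k ∸ d))
      ≡⟨ G-bumps-start B n k 0<k k<B ⟩
    pair B (coeff k 0) (coeff n 0) ∎
    where
    open ≡-Reasoning
    γ : ℕ → ℕ
    γ j = sumℕ (suc j) (λ m → ((suc j) C m) * ((m + (k ∸ j)) ! * stirling2 n (m + (k ∸ j))))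
    -- With d descents there are j = d + 1 runs, so the binomial row j + 1 supplies two more factors
    -- 1+S than there are descents.
    γ-bumps : ∀ d → γ (suc d) ≡ bumps d (bump (bump (coeff 0 n))) (pred k ∸ d)
    γ-bumps d = begin
      γ (suc d)
        ≡⟨ sumℕ-∑ (2 + d) _ ⟩
      ∑ (3 + d) (λ m → ((2 + d) C m) * ((m + (k ∸ suc d)) ! * stirling2 n (m + (k ∸ suc d))))
        ≡⟨ ∑-cong (3 + d) (λ m → cong (((2 + d) C m) *_) (coeff-stirling n (m + (k ∸ suc d)))) ⟨
      ∑ (3 + d) (λ m → ((2 + d) C m) * coeff 0 n (m + (k ∸ suc d)))
        ≡⟨ ∑-binomial (2 + d) (coeff 0 n) (k ∸ suc d) ⟩
      bumps (2 + d) (coeff 0 n) (k ∸ suc d)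
        ≡⟨ cong (bumps (2 + d) (coeff 0 n)) (∸-+-assoc k 1 d) ⟨
      bumps d (bump (bump (coeff 0 n))) (pred k ∸ d) ∎

  -- The Callan condition as a condition on neighbours

  ≤ᵇ-not-<ᵇ : ∀ n i → (n ≤ᵇ i) ≡ not (i <ᵇ n)
  ≤ᵇ-not-<ᵇ zero          i       = refl
  ≤ᵇ-not-<ᵇ (suc n)       zero    = refl
  ≤ᵇ-not-<ᵇ (suc zero)    (suc i) = refl
  ≤ᵇ-not-<ᵇ (suc (suc n)) (suc i) = ≤ᵇ-not-<ᵇ (suc n) i

  allᵇ-cong : ∀ {p q : A → Bool} → (∀ a → p a ≡ q a) → ∀ xs → allᵇ p xs ≡ allᵇ q xs
  allᵇ-cong h []       = refl
  allᵇ-cong h (a ∷ xs) = cong₂ _∧_ (h a) (allᵇ-cong h xs)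

  allᵇ-mono : ∀ {p q : A → Bool} → (∀ a → p a ≡ true → q a ≡ true) → ∀ xs → allᵇ p xs ≡ true →
    allᵇ q xs ≡ true
  allᵇ-mono         h []       e = refl
  allᵇ-mono {p = p} h (a ∷ xs) e with ∧-elim (p a) e
  ... | e₁ , e₂ = cong₂ _∧_ (h a e₁) (allᵇ-mono h xs e₂)

  allᵇ-map : ∀ {B : Set} (p : B → Bool) (f : A → B) xs → allᵇ p (map f xs) ≡ allᵇ (p ∘ f) xs
  allᵇ-map p f []       = refl
  allᵇ-map p f (a ∷ xs) = cong (p (f a) ∧_) (allᵇ-map p f xs)

  allᵇ-++ : ∀ (p : A → Bool) xs ys → allᵇ p (xs ++ ys) ≡ allᵇ p xs ∧ allᵇ p ys
  allᵇ-++ p []       ys = refl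
  allᵇ-++ p (a ∷ xs) ys = trans (cong (p a ∧_) (allᵇ-++ p xs ys)) (sym (∧-assoc (p a) _ _))

  bool-ext : ∀ a b → (a ≡ true → b ≡ true) → (b ≡ true → a ≡ true) → a ≡ b
  bool-ext true  b     f g = sym (f refl)
  bool-ext false false f g = refl
  bool-ext false true  f g = g refl

  module CallanWords (n : ℕ) {m : ℕ} where

    open Words {m} (inN n)

    adjacent : List (Fin m) → Bool
    adjacent []           = true
    adjacent (a ∷ [])     = true
    adjacent (a ∷ b ∷ xs) = not (same (inN n a) (inN n b) ∧ not (toℕ a <ᵇ toℕ b)) ∧ adjacent (b ∷ xs)

    δ-cost : ∀ xs → δ (cost₀ xs) ≡ ⟦ adjacent xs ⟧
    δ-cost []           = refl
    δ-cost (a ∷ [])     = refl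
    δ-cost (a ∷ b ∷ xs) with same (inN n a) (inN n b) ∧ not (toℕ a <ᵇ toℕ b)
       | δ-cost (b ∷ xs)
    ... | true  | _ = refl
    ... | false | h = h

    fine : List (Fin m) → Bool
    fine s = not (allᵇ (inN n) s ∨ allᵇ (inK n) s) ∨ increasing s

    monochromatic-increasing : ∀ c s → allᵇ (λ z → same c (inN n z)) s ≡ true →
                               adjacent s ≡ true → increasing s ≡ true
    monochromatic-increasing c []          _ _ = refl
    monochromatic-increasing c (a ∷ [])    _ _ = refl
    monochromatic-increasing c (a ∷ b ∷ s) h k = cong₂ _∧_
      (lt (same⇒≡ c (proj₁ (∧-elim _ h))) (same⇒≡ c (proj₁ (∧-elim _ h′))) (proj₁ (∧-elim _ k)))
      (monochromatic-increasing c (b ∷ s) h′ (proj₂ (∧-elim (not (same (inN n a) (inN n b) ∧ not (toℕ a <ᵇ toℕ b))) k)))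
      where
      h′ = proj₂ (∧-elim (same c (inN n a)) h)
      lt : inN n a ≡ c → inN n b ≡ c → not (same (inN n a) (inN n b) ∧ not (toℕ a <ᵇ toℕ b)) ≡ true →
           (toℕ a <ᵇ toℕ b) ≡ true
      lt p q e rewrite p | q | same-refl c with toℕ a <ᵇ toℕ b
      ... | true = refl

    allᵇ-inK : ∀ (s : List (Fin m)) → allᵇ (inK n) s ≡ allᵇ (λ z → same false (inN n z)) s
    allᵇ-inK s = allᵇ-cong {p = inK n} {q = λ z → same false (inN n z)} (λ z → ≤ᵇ-not-<ᵇ n (toℕ z)) s

    adjacent⇒fine : ∀ s → adjacent s ≡ true → fine s ≡ true
    adjacent⇒fine s e with allᵇ (inN n) s in eN | allᵇ (inK n) s in eK
    ... | true  | _     = monochromatic-increasing true s eN e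
    ... | false | true  = monochromatic-increasing false s (trans (sym (allᵇ-inK s)) eK) e
    ... | false | false = refl

    adjacent-prefixes : ∀ a xs → adjacent (a ∷ xs) ≡ true → allᵇ (λ s → adjacent (a ∷ s)) (prefixes xs) ≡ true
    adjacent-prefixes a []       e = refl
    adjacent-prefixes a (b ∷ xs) e with ∧-elim (not (same (inN n a) (inN n b) ∧ not (toℕ a <ᵇ toℕ b))) e
    ... | e₁ , e₂ = cong₂ _∧_ (trans (∧-identityʳ _) e₁) (begin
      allᵇ (λ s → adjacent (a ∷ s)) (map (b ∷_) (prefixes xs))
        ≡⟨ allᵇ-map (λ s → adjacent (a ∷ s)) (b ∷_) (prefixes xs) ⟩
      allᵇ (λ s → adjacent (a ∷ b ∷ s)) (prefixes xs)
        ≡⟨ allᵇ-cong (λ s → cong (_∧ adjacent (b ∷ s)) e₁) (prefixes xs) ⟩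
      allᵇ (λ s → adjacent (b ∷ s)) (prefixes xs)               ≡⟨ adjacent-prefixes b xs e₂ ⟩
      true                                                      ∎)
      where open ≡-Reasoning

    fine⇒adjacent : ∀ a b → fine (a ∷ b ∷ []) ≡ true →
      not (same (inN n a) (inN n b) ∧ not (toℕ a <ᵇ toℕ b)) ≡ true
    fine⇒adjacent a b e rewrite ≤ᵇ-not-<ᵇ n (toℕ a) | ≤ᵇ-not-<ᵇ n (toℕ b)
      with toℕ a <ᵇ n | toℕ b <ᵇ n | toℕ a <ᵇ toℕ b
    ... | true  | true  | true  = refl
    ... | true  | false | _     = refl
    ... | false | true  | _     = refl
    ... | false | false | true  = refl

    -- Substrings of length two already force the condition on neighbours; conversely a one-coloured
    -- substring is increasing as soon as all its neighbours are.
    substrings-fine : ∀ xs → allᵇ fine (substrings xs) ≡ adjacent xs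
    substrings-fine xs = bool-ext _ _ (to xs) (from xs)
      where
      to : ∀ xs → allᵇ fine (substrings xs) ≡ true → adjacent xs ≡ true
      to []           e = refl
      to (a ∷ [])     e = refl
      to (a ∷ b ∷ xs) e = cong₂ _∧_ (fine⇒adjacent a b (proj₁ (∧-elim (fine (a ∷ b ∷ [])) e′)))
        (to (b ∷ xs) (proj₂ (∧-elim (allᵇ fine longer)
          (trans (sym (allᵇ-++ fine longer (substrings (b ∷ xs)))) (proj₂ (∧-elim (fine (a ∷ b ∷ [])) e′))))))
        where
        -- The prefixes are a, then a b, then `longer`. Only the pair is used; the others are split
        -- off to reach the substrings of the tail.
        longer = map (a ∷_) (map (b ∷_) (prefixes xs))
        e′ = proj₂ (∧-elim (fine (a ∷ [])) e)
      tail-adjacent : ∀ a xs → adjacent (a ∷ xs) ≡ true → adjacent xs ≡ true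
      tail-adjacent a []       e = refl
      tail-adjacent a (b ∷ xs) e = proj₂ (∧-elim _ e)
      from : ∀ xs → adjacent xs ≡ true → allᵇ fine (substrings xs) ≡ true
      from []       e = refl
      from (a ∷ xs) e = trans (allᵇ-++ fine (prefixes (a ∷ xs)) (substrings xs))
        (cong₂ _∧_ (allᵇ-mono adjacent⇒fine (prefixes (a ∷ xs))
                     (trans (allᵇ-map adjacent (a ∷_) (prefixes xs)) (adjacent-prefixes a xs e)))
                   (from xs (tail-adjacent a xs e)))

  count-N : ∀ n k → count {n + k} (inN n) ≡ n
  count-N zero    zero    = refl
  count-N zero    (suc k) = count-N zero k
  count-N (suc n) k       = cong suc (count-N n k)

  count-K : ∀ n k → count {n + k} (λ z → not (inN n z)) ≡ k
  count-K zero    zero    = refl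
  count-K zero    (suc k) = cong suc (count-K zero k)
  count-K (suc n) k       = count-K n k

  callan-count : ∀ B n k → n < B → k < B →
    wsum (n + k) (λ w → ⟦ isPermutation w ∧ isCallan n k w ⟧) ≡ pair B (coeff n 0) (coeff k 0)
  callan-count B n k n<B k<B = begin
    wsum (n + k) (λ w → ⟦ isPermutation w ∧ isCallan n k w ⟧)
      ≡⟨ wsum-cong (n + k) (λ w → trans (⟦∧⟧ (isPermutation w) (isCallan n k w))
           (cong (⟦ isPermutation w ⟧ *_) (trans (cong ⟦_⟧ (substrings-fine (toList w))) (sym (δ-cost (toList w)))))) ⟩
    wsum (n + k) (λ w → ⟦ distinct (toList w) ⟧ * δ (cost₀ (toList w)))
      ≡⟨ perm-sum (n + k) δ ⟩
    G (n + k) (count {n + k} (inN n)) (count {n + k} (λ z → not (inN n z))) (count {n + k} (inN n)) δ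
      ≡⟨ cong₂ (λ a b → G (n + k) a b a δ) (count-N n k) (count-K n k) ⟩
    G (n + k) n k n δ
      ≡⟨ G-δ B (n + k) n k n refl ≤-refl n<B k<B ⟩
    pair B (coeff⁺ n n) (coeff k 0)
      ≡⟨ pair-congˡ B (coeff k 0) (coeff⁺-diag n) ⟩
    pair B (coeff n 0) (coeff k 0) ∎
    where
    open ≡-Reasoning
    open CallanWords n {n + k}
    open Words {n + k} (inN n)

  callan-↔ : ∀ n k → 0 < k → Callan n k ↔ Fin (callanSum n k)
  callan-↔ n k 0<k = subst (λ N → Callan n k ↔ Fin N) (begin
    wsum (n + k) (λ w → ⟦ isPermutation w ∧ isCallan n k w ⟧)
      ≡⟨ callan-count B n k (s≤s (m≤m+n n k)) (s≤s (m≤n+m k n)) ⟩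
    pair B (coeff n 0) (coeff k 0)
      ≡⟨ pair-comm B (coeff n 0) (coeff k 0) ⟩
    pair B (coeff k 0) (coeff n 0)
      ≡⟨ callanSum-pair B n k 0<k (s≤s (m≤n+m k n)) ⟨
    callanSum n k ∎)
    (words-↔ (n + k) (λ w → isPermutation w ∧ isCallan n k w))
    where
    open ≡-Reasoning
    B = suc (n + k)

module Series where
  open Counting using (coeff; coeff-1+y; coeff-1+y₀; pair; ∑-telescope)
  open import Data.Integer as ℤ using (+_)
  import Data.Integer.Properties as ℤₚ
  import Data.Integer.Tactic.RingSolver as ℤ-Solver
  open import Data.Nat as ℕ using (_∸_; _^_; _!; _<_; s≤s)
  open import Data.Nat.Combinatorics using (_C_; nC1≡n; nCk+nC[k+1]≡[n+1]C[k+1]; k>n⇒nCk≡0)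
  import Data.Nat.Properties as ℕₚ
  import Data.Nat.Tactic.RingSolver as ℕ-Solver
  open import Data.Rational as ℚ using (ℚ; 0ℚ; 1ℚ; _/_; _+_; _*_; _-_; -_; toℚᵘ)
  open import Data.Rational.Properties
  open import Data.Rational.Solver using (module +-*-Solver)
  open +-*-Solver using (solve; _:=_; _:+_; _:*_; _:-_; :-_; con)
  import Data.Rational.Unnormalised as ℚᵘ
  import Data.Rational.Unnormalised.Properties as ℚᵘₚ

  private
    module ∑ℕ = RangeSum ℕₚ.+-*-semiring
    module ∑ℚ = RangeSum (CommutativeRing.semiring +-*-commutativeRing)

  -- Natural numbers and fractions inside ℚ

  ι : ℕ → ℚ
  ι n = + n / 1

  toℚᵘ-/ : ∀ a d → toℚᵘ (a / suc d) ℚᵘ.≃ ℚᵘ.mkℚᵘ a d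
  toℚᵘ-/ a d = toℚᵘ-fromℚᵘ (ℚᵘ.mkℚᵘ a d)

  ι-+ : ∀ a b → ι (a ℕ.+ b) ≡ ι a + ι b
  ι-+ a b = toℚᵘ-injective (begin
    toℚᵘ (ι (a ℕ.+ b))                          ≈⟨ toℚᵘ-/ (+ (a ℕ.+ b)) 0 ⟩
    ℚᵘ.mkℚᵘ (+ (a ℕ.+ b)) 0                     ≈⟨ ℚᵘ.*≡* (cong (ℤ._* + 1) (cong₂ ℤ._+_ (sym (ℤₚ.*-identityʳ (+ a))) (sym (ℤₚ.*-identityʳ (+ b))))) ⟩
    ℚᵘ.mkℚᵘ (+ a) 0 ℚᵘ.+ ℚᵘ.mkℚᵘ (+ b) 0        ≈⟨ ℚᵘₚ.+-cong (toℚᵘ-/ (+ a) 0) (toℚᵘ-/ (+ b) 0) ⟨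
    toℚᵘ (ι a) ℚᵘ.+ toℚᵘ (ι b)                  ≈⟨ toℚᵘ-homo-+ (ι a) (ι b) ⟨
    toℚᵘ (ι a + ι b)                            ∎)
    where open import Relation.Binary.Reasoning.Setoid ℚᵘₚ.≃-setoid

  ι-* : ∀ a b → ι (a ℕ.* b) ≡ ι a * ι b
  ι-* a b = toℚᵘ-injective (begin
    toℚᵘ (ι (a ℕ.* b))                          ≈⟨ toℚᵘ-/ (+ (a ℕ.* b)) 0 ⟩
    ℚᵘ.mkℚᵘ (+ (a ℕ.* b)) 0                     ≈⟨ ℚᵘ.*≡* (cong (ℤ._* + 1) (ℤₚ.pos-* a b)) ⟩
    ℚᵘ.mkℚᵘ (+ a) 0 ℚᵘ.* ℚᵘ.mkℚᵘ (+ b) 0        ≈⟨ ℚᵘₚ.*-cong (toℚᵘ-/ (+ a) 0) (toℚᵘ-/ (+ b) 0) ⟨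
    toℚᵘ (ι a) ℚᵘ.* toℚᵘ (ι b)                  ≈⟨ toℚᵘ-homo-* (ι a) (ι b) ⟨
    toℚᵘ (ι a * ι b)                            ∎)
    where open import Relation.Binary.Reasoning.Setoid ℚᵘₚ.≃-setoid

  -- The denominator has this shape because (n+1)! unfolds to the product of n+1 and n!; it is
  -- applied with d = n!.
  cancel-/ : ∀ c s d .{{_ : ℕ.NonZero d}} .{{_ : ℕ.NonZero (suc c ℕ.* d)}} →
             ι (suc c) * ((ℤ.- s) / (suc c ℕ.* d)) ≡ - (s / d)
  cancel-/ c s (suc d) = toℚᵘ-injective (begin
    toℚᵘ (ι (suc c) * ((ℤ.- s) / (suc c ℕ.* suc d)))
      ≈⟨ toℚᵘ-homo-* (ι (suc c)) ((ℤ.- s) / (suc c ℕ.* suc d)) ⟩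
    toℚᵘ (ι (suc c)) ℚᵘ.* toℚᵘ ((ℤ.- s) / (suc c ℕ.* suc d))
      ≈⟨ ℚᵘₚ.*-cong (toℚᵘ-/ (+ suc c) 0) (toℚᵘ-/ (ℤ.- s) (d ℕ.+ c ℕ.* suc d)) ⟩
    ℚᵘ.mkℚᵘ (+ suc c) 0 ℚᵘ.* ℚᵘ.mkℚᵘ (ℤ.- s) (d ℕ.+ c ℕ.* suc d)
      ≈⟨ ℚᵘ.*≡* cross ⟩
    ℚᵘ.- ℚᵘ.mkℚᵘ s d
      ≈⟨ ℚᵘₚ.-‿cong (toℚᵘ-/ s d) ⟨
    ℚᵘ.- toℚᵘ (s / suc d)
      ≈⟨ toℚᵘ-homo‿- (s / suc d) ⟨
    toℚᵘ (- (s / suc d)) ∎)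
    where
    open import Relation.Binary.Reasoning.Setoid ℚᵘₚ.≃-setoid
    cross : + suc c ℤ.* (ℤ.- s) ℤ.* + suc d ≡ (ℤ.- s) ℤ.* + (1 ℕ.* (suc c ℕ.* suc d))
    cross rewrite ℕₚ.+-identityʳ (suc c ℕ.* suc d) | ℤₚ.pos-* (suc c) (suc d) = assoc (+ suc c) (ℤ.- s) (+ suc d)
      where
      assoc : ∀ a b c → a ℤ.* b ℤ.* c ≡ b ℤ.* (a ℤ.* c)
      assoc = ℤ-Solver.solve-∀

  signℤ-suc : ∀ n → signℤ (suc n) ≡ ℤ.- signℤ n
  signℤ-suc zero          = refl
  signℤ-suc (suc zero)    = refl
  signℤ-suc (suc (suc n)) = signℤ-suc n

  expNeg-suc : ∀ n → ι (suc n) * expNeg (suc n) ≡ - expNeg n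
  expNeg-suc n rewrite signℤ-suc n = cancel-/ n (signℤ n) (n !) {{n ℕₚ.!≢0}} {{suc n ℕₚ.!≢0}}

  -- Derivatives of the powers of 1 - e^(-x)

  u : PS
  u = oneMinusExpNeg

  deriv : PS → PS
  deriv f n = ι (suc n) * f (suc n)

  deriv-u : ∀ n → deriv u n ≡ oneS n - u n
  deriv-u n = begin
    ι (suc n) * (0ℚ - expNeg (suc n))   ≡⟨ lem₁ (ι (suc n)) (expNeg (suc n)) ⟩
    - (ι (suc n) * expNeg (suc n))      ≡⟨ cong -_ (expNeg-suc n) ⟩
    - (- expNeg n)                      ≡⟨ lem₂ (oneS n) (expNeg n) ⟩
    oneS n - (oneS n - expNeg n)        ∎
    where
    open ≡-Reasoning
    lem₁ : ∀ a b → a * (0ℚ - b) ≡ - (a * b)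
    lem₁ = solve 2 (λ a b → a :* (con 0ℚ :- b) := :- (a :* b)) refl
    lem₂ : ∀ a b → - (- b) ≡ a - (a - b)
    lem₂ = solve 2 (λ a b → :- (:- b) := a :- (a :- b)) refl

  sumℚ-∑ : ∀ n f → sumℚ n f ≡ ∑ℚ.∑ (suc n) f
  sumℚ-∑ zero    f = sym (+-identityˡ (f 0))
  sumℚ-∑ (suc n) f = cong (_+ f (suc n)) (sumℚ-∑ n f)

  conv : PS → PS → PS
  conv f g n = ∑ℚ.∑ (suc n) (λ i → f i * g (n ∸ i))

  *S-conv : ∀ f g n → (f *S g) n ≡ conv f g n
  *S-conv f g n = sumℚ-∑ n (λ i → f i * g (n ∸ i))

  conv-congˡ : ∀ {f f′} g n → (∀ i → f i ≡ f′ i) → conv f g n ≡ conv f′ g n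
  conv-congˡ g n h = ∑ℚ.∑-cong (suc n) (λ i → cong (_* g (n ∸ i)) (h i))

  conv-congʳ : ∀ f {g g′} n → (∀ i → g i ≡ g′ i) → conv f g n ≡ conv f g′ n
  conv-congʳ f n h = ∑ℚ.∑-cong (suc n) (λ i → cong (f i *_) (h (n ∸ i)))

  conv-oneˡ : ∀ g n → conv oneS g n ≡ g n
  conv-oneˡ g n = trans (∑ℚ.∑-front n (λ i → oneS i * g (n ∸ i))) (trans
    (cong₂ _+_ (*-identityˡ (g n)) (∑ℚ.∑-zero n (λ i → *-zeroˡ (g (n ∸ suc i)))))
    (+-identityʳ (g n)))

  ∑-- : ∀ n f g → ∑ℚ.∑ n (λ i → f i - g i) ≡ ∑ℚ.∑ n f - ∑ℚ.∑ n g
  ∑-- zero    f g = refl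
  ∑-- (suc n) f g rewrite ∑-- n f g = lem (∑ℚ.∑ n f) (∑ℚ.∑ n g) (f n) (g n)
    where
    lem : ∀ a b c d → a - b + (c - d) ≡ a + c - (b + d)
    lem = solve 4 (λ a b c d → a :- b :+ (c :- d) := a :+ c :- (b :+ d)) refl

  conv--ˡ : ∀ f f′ g n → conv (f -S f′) g n ≡ conv f g n - conv f′ g n
  conv--ˡ f f′ g n = trans (∑ℚ.∑-cong (suc n) (λ i → lem (f i) (f′ i) (g (n ∸ i)))) (∑-- (suc n) _ _)
    where
    lem : ∀ a b c → (a - b) * c ≡ a * c - b * c
    lem = solve 3 (λ a b c → (a :- b) :* c := a :* c :- b :* c) refl

  conv-scaled--ʳ : ∀ a f g g′ n → conv f (λ i → a * (g i - g′ i)) n ≡ a * (conv f g n - conv f g′ n)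
  conv-scaled--ʳ a f g g′ n = trans (∑ℚ.∑-cong (suc n) (λ i → lem a (f i) (g (n ∸ i)) (g′ (n ∸ i))))
    (trans (∑ℚ.∑-*ˡ (suc n) a _) (cong (a *_) (∑-- (suc n) _ _)))
    where
    lem : ∀ a b c d → b * (a * (c - d)) ≡ a * (b * c - b * d)
    lem = solve 4 (λ a b c d → b :* (a :* (c :- d)) := a :* (b :* c :- b :* d)) refl

  -- On the i-th summand the factor n+1 is split as i + (n+1-i). Each half has one vanishing end, at
  -- i = 0 and at i = n+1 respectively, and what remains is a convolution of order n.
  leibniz : ∀ f g n → deriv (conv f g) n ≡ conv (deriv f) g n + conv f (deriv g) n
  leibniz f g n = begin
    ι (suc n) * ∑ℚ.∑ (2 ℕ.+ n) (λ i → f i * g (suc n ∸ i))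
      ≡⟨ ∑ℚ.∑-*ˡ (2 ℕ.+ n) (ι (suc n)) _ ⟨
    ∑ℚ.∑ (2 ℕ.+ n) (λ i → ι (suc n) * (f i * g (suc n ∸ i)))
      ≡⟨ ∑ℚ.∑-cong-< (2 ℕ.+ n) (λ i i<2+n → trans
           (cong (λ m → ι m * (f i * g (suc n ∸ i))) (sym (ℕₚ.m+[n∸m]≡n (ℕ.s≤s⁻¹ i<2+n))))
           (trans (cong (_* (f i * g (suc n ∸ i))) (ι-+ i (suc n ∸ i))) (lem (ι i) (ι (suc n ∸ i)) (f i) (g (suc n ∸ i))))) ⟩
    ∑ℚ.∑ (2 ℕ.+ n) (λ i → L i + R i)
      ≡⟨ ∑ℚ.∑-+ (2 ℕ.+ n) L R ⟩
    ∑ℚ.∑ (2 ℕ.+ n) L + ∑ℚ.∑ (2 ℕ.+ n) R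
      ≡⟨ cong₂ _+_ left right ⟩
    conv (deriv f) g n + conv f (deriv g) n ∎
    where
    open ≡-Reasoning
    L R : ℕ → ℚ
    L i = ι i * f i * g (suc n ∸ i)
    R i = f i * (ι (suc n ∸ i) * g (suc n ∸ i))
    lem : ∀ a b c d → (a + b) * (c * d) ≡ a * c * d + c * (b * d)
    lem = solve 4 (λ a b c d → (a :+ b) :* (c :* d) := a :* c :* d :+ c :* (b :* d)) refl
    left : ∑ℚ.∑ (2 ℕ.+ n) L ≡ conv (deriv f) g n
    left = trans (∑ℚ.∑-front (suc n) L) (trans
      (cong (_+ conv (deriv f) g n) (trans (cong (_* g (suc n)) (*-zeroˡ (f 0))) (*-zeroˡ (g (suc n)))))
      (+-identityˡ _))
    right : ∑ℚ.∑ (2 ℕ.+ n) R ≡ conv f (deriv g) n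
    right = trans (cong₂ _+_
        (∑ℚ.∑-cong-< (suc n) (λ i i<1+n → cong (λ m → f i * (ι m * g m)) (ℕₚ.+-∸-assoc 1 (ℕ.s≤s⁻¹ i<1+n))))
        (trans (cong (λ m → f (suc n) * (ι m * g m)) (ℕₚ.n∸n≡0 n))
               (trans (cong (f (suc n) *_) (*-zeroˡ (g 0))) (*-zeroʳ (f (suc n))))))
      (+-identityʳ _)

  P : ℕ → PS
  P = powS u

  -- In the product rule u′ = 1 - u gives one copy of u^j - u^(j+1), and u (u^j)′ gives j further
  -- copies by induction.
  deriv-P : ∀ j n → deriv (P (suc j)) n ≡ ι (suc j) * (P j n - P (suc j) n)
  deriv-P j n = begin
    ι (suc n) * P (suc j) (suc n)
      ≡⟨ cong (ι (suc n) *_) (*S-conv u (P j) (suc n)) ⟩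
    deriv (conv u (P j)) n
      ≡⟨ leibniz u (P j) n ⟩
    conv (deriv u) (P j) n + conv u (deriv (P j)) n
      ≡⟨ cong₂ _+_ first (second j) ⟩
    (P j n - P (suc j) n) + ι j * (P j n - P (suc j) n)
      ≡⟨ lem (ι j) _ ⟩
    (ι 1 + ι j) * (P j n - P (suc j) n)
      ≡⟨ cong (_* (P j n - P (suc j) n)) (ι-+ 1 j) ⟨
    ι (suc j) * (P j n - P (suc j) n) ∎
    where
    open ≡-Reasoning
    lem : ∀ a b → b + a * b ≡ (1ℚ + a) * b
    lem a b = sym (trans (*-distribʳ-+ b 1ℚ a) (cong (_+ a * b) (*-identityˡ b)))
    first : conv (deriv u) (P j) n ≡ P j n - P (suc j) n
    first = trans (conv-congˡ (P j) n deriv-u) (trans (conv--ˡ oneS u (P j) n)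
      (cong₂ _-_ (conv-oneˡ (P j) n) (sym (*S-conv u (P j) n))))
    second : ∀ j → conv u (deriv (P j)) n ≡ ι j * (P j n - P (suc j) n)
    second zero    = trans (∑ℚ.∑-zero (suc n) (λ i → trans (cong (u i *_) (*-zeroʳ (ι (suc (n ∸ i))))) (*-zeroʳ (u i))))
                           (sym (*-zeroˡ (P 0 n - P 1 n)))
    second (suc j) = trans (conv-congʳ u n (deriv-P j)) (trans
      (conv-scaled--ʳ (ι (suc j)) u (P j) (P (suc j)) n)
      (cong (ι (suc j) *_) (cong₂ _-_ (sym (*S-conv u (P j) n)) (sym (*S-conv u (P (suc j)) n)))))

  -- The array n! [x^n] u^j

  F : ℕ → ℕ → ℚ
  F j n = ι (n !) * P j n

  F-0suc : ∀ n → F 0 (suc n) ≡ 0ℚ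
  F-0suc n = *-zeroʳ (ι (suc n !))

  F-suc0 : ∀ j → F (suc j) 0 ≡ 0ℚ
  F-suc0 j = trans (*-identityˡ (u 0 * P j 0)) (*-zeroˡ (P j 0))

  F-suc : ∀ j n → F (suc j) (suc n) ≡ ι (suc j) * (F j n - F (suc j) n)
  F-suc j n = begin
    ι (suc n !) * P (suc j) (suc n)
      ≡⟨ cong (_* P (suc j) (suc n)) (ι-* (suc n) (n !)) ⟩
    ι (suc n) * ι (n !) * P (suc j) (suc n)
      ≡⟨ lem₁ (ι (suc n)) (ι (n !)) (P (suc j) (suc n)) ⟩
    ι (n !) * (ι (suc n) * P (suc j) (suc n))
      ≡⟨ cong (ι (n !) *_) (deriv-P j n) ⟩
    ι (n !) * (ι (suc j) * (P j n - P (suc j) n))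
      ≡⟨ lem₂ (ι (n !)) (ι (suc j)) (P j n) (P (suc j) n) ⟩
    ι (suc j) * (F j n - F (suc j) n) ∎
    where
    open ≡-Reasoning
    lem₁ : ∀ a b c → a * b * c ≡ b * (a * c)
    lem₁ = solve 3 (λ a b c → a :* b :* c := b :* (a :* c)) refl
    lem₂ : ∀ a b c d → a * (b * (c - d)) ≡ b * (a * c - a * d)
    lem₂ = solve 4 (λ a b c d → a :* (b :* (c :- d)) := b :* (a :* c :- a :* d)) refl

  -- The series u has no constant term, so u^j starts in degree j. This removes the upper boundary
  -- term in `abel`.
  F-> : ∀ j n → n < j → F j n ≡ 0ℚ
  F-> (suc j) zero    h       = F-suc0 j
  F-> (suc j) (suc n) (s≤s h) = trans (F-suc j n) (trans
    (cong (ι (suc j) *_) (cong₂ _-_ (F-> j n h) (F-> (suc j) n (ℕₚ.<-trans h (ℕₚ.n<1+n j)))))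
    (*-zeroʳ (ι (suc j))))

  -- The binomial transform of the array and the expansion of powers

  C-absorb : ∀ j i → suc j ℕ.* (j C i) ≡ suc i ℕ.* (suc j C suc i)
  C-absorb zero    zero    = refl
  C-absorb zero    (suc i) = sym (ℕₚ.*-zeroʳ (suc (suc i)))
  C-absorb (suc j) zero    = trans (ℕₚ.*-identityʳ (2 ℕ.+ j)) (sym (trans (ℕₚ.*-identityˡ _) (nC1≡n (2 ℕ.+ j))))
  C-absorb (suc j) (suc i) = begin
    suc (suc j) ℕ.* p                                       ≡⟨⟩
    p ℕ.+ suc j ℕ.* p
      ≡⟨ cong (λ q → p ℕ.+ suc j ℕ.* q) (nCk+nC[k+1]≡[n+1]C[k+1] j i) ⟨
    p ℕ.+ suc j ℕ.* (j C i ℕ.+ j C suc i)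
      ≡⟨ cong (p ℕ.+_) (ℕₚ.*-distribˡ-+ (suc j) (j C i) (j C suc i)) ⟩
    p ℕ.+ (suc j ℕ.* (j C i) ℕ.+ suc j ℕ.* (j C suc i))
      ≡⟨ cong₂ (λ q r → p ℕ.+ (q ℕ.+ r)) (C-absorb j i) (C-absorb j (suc i)) ⟩
    p ℕ.+ (suc i ℕ.* p ℕ.+ suc (suc i) ℕ.* q)               ≡⟨ ℕₚ.+-assoc p (suc i ℕ.* p) _ ⟨
    suc (suc i) ℕ.* p ℕ.+ suc (suc i) ℕ.* q                 ≡⟨ ℕₚ.*-distribˡ-+ (suc (suc i)) p q ⟨
    suc (suc i) ℕ.* (p ℕ.+ q)
      ≡⟨ cong (suc (suc i) ℕ.*_) (nCk+nC[k+1]≡[n+1]C[k+1] (suc j) (suc i)) ⟩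
    suc (suc i) ℕ.* (suc (suc j) C suc (suc i))             ∎
    where
    open ≡-Reasoning
    p = suc j C suc i
    q = suc j C suc (suc i)

  C-raise : ∀ j i → suc j ℕ.* (j C i) ≡ suc i ℕ.* (j C i ℕ.+ j C suc i)
  C-raise j i = trans (C-absorb j i) (cong (suc i ℕ.*_) (sym (nCk+nC[k+1]≡[n+1]C[k+1] j i)))

  -- This is the increment of j C(j,i+1) as j grows by one. Its two weights are those of
  -- `coeff-1+y`, and so the binomial transform inherits the recursion of (1+y)^n.
  C-step : ∀ j i → suc j ℕ.* (suc j C suc i) ≡
    j ℕ.* (j C suc i) ℕ.+ (suc (suc i) ℕ.* (j C suc i) ℕ.+ suc i ℕ.* (j C i))
  C-step j i = begin
    suc j ℕ.* (suc j C suc i)                        ≡⟨ cong (suc j ℕ.*_) (nCk+nC[k+1]≡[n+1]C[k+1] j i) ⟨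
    suc j ℕ.* (a ℕ.+ b)                              ≡⟨ ℕₚ.*-distribˡ-+ (suc j) a b ⟩
    suc j ℕ.* a ℕ.+ suc j ℕ.* b                      ≡⟨ cong (ℕ._+ suc j ℕ.* b) (C-raise j i) ⟩
    suc i ℕ.* (a ℕ.+ b) ℕ.+ suc j ℕ.* b              ≡⟨ lem i j a b ⟩
    j ℕ.* b ℕ.+ (suc (suc i) ℕ.* b ℕ.+ suc i ℕ.* a)  ∎
    where
    open ≡-Reasoning
    a = j C i
    b = j C suc i
    lem : ∀ i j a b → suc i ℕ.* (a ℕ.+ b) ℕ.+ suc j ℕ.* b ≡ j ℕ.* b ℕ.+ (suc (suc i) ℕ.* b ℕ.+ suc i ℕ.* a)
    lem = ℕ-Solver.solve-∀

  -- Summation by parts. Moving the difference from `F` to `c` leaves boundary terms at j = 0 and j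
  -- = n+1: the first vanishes by c 0 = 0, the second by `F->`.
  abel : ∀ n (c w : ℕ → ℕ) → c 0 ≡ 0 → (∀ j → c (suc j) ≡ c j ℕ.+ w j) →
    ∑ℚ.∑ (suc n) (λ j → ι (c (suc j)) * (F j n - F (suc j) n)) ≡ ∑ℚ.∑ (suc n) (λ j → ι (w j) * F j n)
  abel n c w c0 cw = begin
    ∑ℚ.∑ (suc n) (λ j → ι (c (suc j)) * (F j n - F (suc j) n))
      ≡⟨ ∑ℚ.∑-cong (suc n) (λ j → trans (lem₁ (ι (c (suc j))) (F j n) (F (suc j) n))
           (cong (λ a → a * F j n - t (suc j)) (trans (cong ι (cw j)) (ι-+ (c j) (w j))))) ⟩
    ∑ℚ.∑ (suc n) (λ j → (ι (c j) + ι (w j)) * F j n - t (suc j))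
      ≡⟨ ∑-- (suc n) _ _ ⟩
    ∑ℚ.∑ (suc n) (λ j → (ι (c j) + ι (w j)) * F j n) - ∑ℚ.∑ (suc n) (t ∘ suc)
      ≡⟨ cong₂ _-_ (trans (∑ℚ.∑-cong (suc n) (λ j → *-distribʳ-+ (F j n) (ι (c j)) (ι (w j)))) (∑ℚ.∑-+ (suc n) t _)) shift ⟩
    (∑ℚ.∑ (suc n) t + ∑ℚ.∑ (suc n) (λ j → ι (w j) * F j n)) - ∑ℚ.∑ (suc n) t
      ≡⟨ lem₂ (∑ℚ.∑ (suc n) t) _ ⟩
    ∑ℚ.∑ (suc n) (λ j → ι (w j) * F j n) ∎
    where
    open ≡-Reasoning
    t : ℕ → ℚ
    t j = ι (c j) * F j n
    lem₁ : ∀ a b d → a * (b - d) ≡ a * b - a * d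
    lem₁ = solve 3 (λ a b d → a :* (b :- d) := a :* b :- a :* d) refl
    lem₂ : ∀ a b → (a + b) - a ≡ b
    lem₂ = solve 2 (λ a b → (a :+ b) :- a := b) refl
    shift : ∑ℚ.∑ (suc n) (t ∘ suc) ≡ ∑ℚ.∑ (suc n) t
    shift = begin
      ∑ℚ.∑ (suc n) (t ∘ suc)          ≡⟨ +-identityˡ _ ⟨
      0ℚ + ∑ℚ.∑ (suc n) (t ∘ suc)
        ≡⟨ cong (_+ ∑ℚ.∑ (suc n) (t ∘ suc)) (trans (cong (λ r → ι r * F 0 n) c0) (*-zeroˡ (F 0 n))) ⟨
      t 0 + ∑ℚ.∑ (suc n) (t ∘ suc)    ≡⟨ ∑ℚ.∑-front (suc n) t ⟨
      ∑ℚ.∑ (suc n) t + t (suc n)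
        ≡⟨ cong (λ r → ∑ℚ.∑ (suc n) t + r) (trans (cong (ι (c (suc n)) *_) (F-> (suc n) n (ℕₚ.n<1+n n))) (*-zeroʳ (ι (c (suc n))))) ⟩
      ∑ℚ.∑ (suc n) t + 0ℚ             ≡⟨ +-identityʳ _ ⟩
      ∑ℚ.∑ (suc n) t                  ∎

  -- Induction on n: `F-suc` supplies a factor j+1 and a difference in j, and summation by parts
  -- turns these into multiplication by 1+y on the binomial basis.
  binomial-transform : ∀ n i → ∑ℚ.∑ (suc n) (λ j → ι (j C i) * F j n) ≡ ι (coeff n 0 i)
  binomial-transform zero    zero    = refl
  binomial-transform zero    (suc i) = refl
  binomial-transform (suc n) i = begin
    ∑ℚ.∑ (2 ℕ.+ n) (λ j → ι (j C i) * F j (suc n))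
      ≡⟨ ∑ℚ.∑-front (suc n) (λ j → ι (j C i) * F j (suc n)) ⟩
    ι (0 C i) * F 0 (suc n) + ∑ℚ.∑ (suc n) (λ j → ι (suc j C i) * F (suc j) (suc n))
      ≡⟨ cong₂ _+_ (trans (cong (ι (0 C i) *_) (F-0suc n)) (*-zeroʳ (ι (0 C i))))
           (∑ℚ.∑-cong (suc n) (λ j → trans (cong (ι (suc j C i) *_) (F-suc j n)) (trans
             (lem (ι (suc j C i)) (ι (suc j)) _) (cong (_* (F j n - F (suc j) n)) (sym (ι-* (suc j) (suc j C i))))))) ⟩
    0ℚ + ∑ℚ.∑ (suc n) (λ j → ι (suc j ℕ.* (suc j C i)) * (F j n - F (suc j) n))
      ≡⟨ +-identityˡ _ ⟩
    ∑ℚ.∑ (suc n) (λ j → ι (suc j ℕ.* (suc j C i)) * (F j n - F (suc j) n))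
      ≡⟨ evaluate i ⟩
    ι (coeff (suc n) 0 i) ∎
    where
    open ≡-Reasoning
    lem : ∀ a b c → a * (b * c) ≡ b * a * c
    lem = solve 3 (λ a b c → a :* (b :* c) := b :* a :* c) refl
    evaluate : ∀ i →
      ∑ℚ.∑ (suc n) (λ j → ι (suc j ℕ.* (suc j C i)) * (F j n - F (suc j) n)) ≡ ι (coeff (suc n) 0 i)
    evaluate zero    = trans
      (abel n (λ j → j ℕ.* (j C 0)) (λ j → j C 0) refl (λ j → ℕₚ.+-comm 1 (j ℕ.* 1)))
      (trans (binomial-transform n 0) (cong ι (sym (coeff-1+y₀ n 0))))
    evaluate (suc i) = begin
      ∑ℚ.∑ (suc n) (λ j → ι (suc j ℕ.* (suc j C suc i)) * (F j n - F (suc j) n))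
        ≡⟨ abel n (λ j → j ℕ.* (j C suc i)) (λ j → suc (suc i) ℕ.* (j C suc i) ℕ.+ suc i ℕ.* (j C i)) refl (λ j → C-step j i) ⟩
      ∑ℚ.∑ (suc n) (λ j → ι (suc (suc i) ℕ.* (j C suc i) ℕ.+ suc i ℕ.* (j C i)) * F j n)
        ≡⟨ ∑ℚ.∑-cong (suc n) (λ j → trans (cong (_* F j n) (trans (ι-+ (suc (suc i) ℕ.* (j C suc i)) (suc i ℕ.* (j C i)))
             (cong₂ _+_ (ι-* (suc (suc i)) (j C suc i)) (ι-* (suc i) (j C i)))))
             (lem′ (ι (suc (suc i))) (ι (j C suc i)) (ι (suc i)) (ι (j C i)) (F j n))) ⟩
      ∑ℚ.∑ (suc n) (λ j → ι (suc (suc i)) * (ι (j C suc i) * F j n) + ι (suc i) * (ι (j C i) * F j n))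
        ≡⟨ trans (∑ℚ.∑-+ (suc n) _ _) (cong₂ _+_ (∑ℚ.∑-*ˡ (suc n) (ι (suc (suc i))) _) (∑ℚ.∑-*ˡ (suc n) (ι (suc i)) _)) ⟩
      ι (suc (suc i)) * ∑ℚ.∑ (suc n) (λ j → ι (j C suc i) * F j n) + ι (suc i) * ∑ℚ.∑ (suc n) (λ j → ι (j C i) * F j n)
        ≡⟨ cong₂ (λ p q → ι (suc (suc i)) * p + ι (suc i) * q) (binomial-transform n (suc i)) (binomial-transform n i) ⟩
      ι (suc (suc i)) * ι (coeff n 0 (suc i)) + ι (suc i) * ι (coeff n 0 i)
        ≡⟨ trans (ι-+ (suc (suc i) ℕ.* coeff n 0 (suc i)) (suc i ℕ.* coeff n 0 i))
                 (cong₂ _+_ (ι-* (suc (suc i)) (coeff n 0 (suc i))) (ι-* (suc i) (coeff n 0 i))) ⟨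
      ι (suc (suc i) ℕ.* coeff n 0 (suc i) ℕ.+ suc i ℕ.* coeff n 0 i)
        ≡⟨ cong ι (coeff-1+y n 0 i) ⟨
      ι (coeff (suc n) 0 (suc i)) ∎
      where
      lem′ : ∀ a b c d e → (a * b + c * d) * e ≡ a * (b * e) + c * (d * e)
      lem′ = solve 5 (λ a b c d e → (a :* b :+ c :* d) :* e := a :* (b :* e) :+ c :* (d :* e)) refl

  -- The expansion of (1+y)^k evaluated at y = j. By `C-raise` a further factor j+1 spreads the i-th
  -- term over i and i+1; `t` collects the part that moves up. Since C(j,B) = 0 for j < B, nothing
  -- is pushed past the cutoff.
  power-binomial : ∀ B k j → j < B → suc j ^ k ≡ pair B (j C_) (coeff k 0)
  power-binomial (suc B) zero    j j<B = sym (trans (∑ℕ.∑-front B (λ i → (j C i) ℕ.* coeff 0 0 i))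
    (cong (λ r → 1 ℕ.+ r) (∑ℕ.∑-zero B (λ i → ℕₚ.*-zeroʳ (j C suc i)))))
  power-binomial B       (suc k) j j<B = begin
    suc j ℕ.* suc j ^ k
      ≡⟨ cong (suc j ℕ.*_) (power-binomial B k j j<B) ⟩
    suc j ℕ.* pair B (j C_) (coeff k 0)
      ≡⟨ ∑ℕ.∑-*ˡ B (suc j) _ ⟨
    ∑ℕ.∑ B (λ i → suc j ℕ.* ((j C i) ℕ.* coeff k 0 i))
      ≡⟨ ∑ℕ.∑-cong B (λ i → trans (sym (ℕₚ.*-assoc (suc j) (j C i) (coeff k 0 i))) (trans
           (cong (ℕ._* coeff k 0 i) (C-raise j i)) (lem (suc i) (j C i) (j C suc i) (coeff k 0 i)))) ⟩
    ∑ℕ.∑ B (λ i → s i ℕ.+ t (suc i))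
      ≡⟨ ∑ℕ.∑-+ B s (t ∘ suc) ⟩
    ∑ℕ.∑ B s ℕ.+ ∑ℕ.∑ B (t ∘ suc)
      ≡⟨ cong (∑ℕ.∑ B s ℕ.+_) shift ⟩
    ∑ℕ.∑ B s ℕ.+ ∑ℕ.∑ B t
      ≡⟨ ∑ℕ.∑-+ B s t ⟨
    ∑ℕ.∑ B (λ i → s i ℕ.+ t i)
      ≡⟨ ∑ℕ.∑-cong B pt ⟩
    pair B (j C_) (coeff (suc k) 0) ∎
    where
    open ≡-Reasoning
    s t : ℕ → ℕ
    s i = suc i ℕ.* (j C i) ℕ.* coeff k 0 i
    t zero    = 0
    t (suc i) = suc i ℕ.* (j C suc i) ℕ.* coeff k 0 i
    lem : ∀ a b c d → a ℕ.* (b ℕ.+ c) ℕ.* d ≡ a ℕ.* b ℕ.* d ℕ.+ a ℕ.* c ℕ.* d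
    lem = ℕ-Solver.solve-∀
    t-end : ∀ B → j < B → t B ≡ 0
    t-end (suc i) h rewrite k>n⇒nCk≡0 h | ℕₚ.*-zeroʳ i = refl
    shift : ∑ℕ.∑ B (t ∘ suc) ≡ ∑ℕ.∑ B t
    shift = trans (sym (ℕₚ.+-identityʳ _)) (trans (∑-telescope B t)
      (trans (cong (∑ℕ.∑ B t ℕ.+_) (t-end B j<B)) (ℕₚ.+-identityʳ _)))
    pt : ∀ i → s i ℕ.+ t i ≡ (j C i) ℕ.* coeff (suc k) 0 i
    pt zero    = trans (ℕₚ.+-identityʳ _) (cong (1 ℕ.*_) (sym (coeff-1+y₀ k 0)))
    pt (suc i) = trans (lem′ (suc i) (j C suc i) (coeff k 0 (suc i)) (coeff k 0 i))
                       (cong ((j C suc i) ℕ.*_) (sym (coeff-1+y k 0 i)))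
      where
      lem′ : ∀ a c y z → suc a ℕ.* c ℕ.* y ℕ.+ a ℕ.* c ℕ.* z ≡ c ℕ.* (suc a ℕ.* y ℕ.+ a ℕ.* z)
      lem′ = ℕ-Solver.solve-∀

  ι-∑ : ∀ n f → ι (∑ℕ.∑ n f) ≡ ∑ℚ.∑ n (ι ∘ f)
  ι-∑ zero    f = refl
  ι-∑ (suc n) f = trans (ι-+ (∑ℕ.∑ n f) (f n)) (cong (_+ ι (f n)) (ι-∑ n f))

  polyBernoulli-pair : ∀ B n k → n < B → polyBernoulli n k ≡ ι (pair B (coeff n 0) (coeff k 0))
  polyBernoulli-pair B n k n<B = begin
    ι (n !) * sumℚ n (λ j → ι (suc j ^ k) * P j n)
      ≡⟨ cong (ι (n !) *_) (sumℚ-∑ n _) ⟩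
    ι (n !) * ∑ℚ.∑ (suc n) (λ j → ι (suc j ^ k) * P j n)
      ≡⟨ ∑ℚ.∑-*ˡ (suc n) (ι (n !)) _ ⟨
    ∑ℚ.∑ (suc n) (λ j → ι (n !) * (ι (suc j ^ k) * P j n))
      ≡⟨ ∑ℚ.∑-cong-< (suc n) (λ j j≤n → trans (lem₁ (ι (n !)) (ι (suc j ^ k)) (P j n)) (trans
           (cong (λ r → ι r * F j n) (power-binomial B k j (ℕₚ.≤-trans j≤n n<B)))
           (trans (cong (_* F j n) (ι-∑ B _)) (sym (∑ℚ.∑-*ʳ B (F j n) _))))) ⟩
    ∑ℚ.∑ (suc n) (λ j → ∑ℚ.∑ B (λ i → ι ((j C i) ℕ.* coeff k 0 i) * F j n))
      ≡⟨ ∑ℚ.∑-swap (suc n) B (λ j i → ι ((j C i) ℕ.* coeff k 0 i) * F j n) ⟩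
    ∑ℚ.∑ B (λ i → ∑ℚ.∑ (suc n) (λ j → ι ((j C i) ℕ.* coeff k 0 i) * F j n))
      ≡⟨ ∑ℚ.∑-cong B (λ i → trans
           (∑ℚ.∑-cong (suc n) (λ j → trans (cong (_* F j n) (ι-* (j C i) (coeff k 0 i))) (lem₂ (ι (j C i)) (ι (coeff k 0 i)) (F j n))))
           (trans (∑ℚ.∑-*ʳ (suc n) (ι (coeff k 0 i)) _)
             (trans (cong (_* ι (coeff k 0 i)) (binomial-transform n i)) (sym (ι-* (coeff n 0 i) (coeff k 0 i)))))) ⟩
    ∑ℚ.∑ B (λ i → ι (coeff n 0 i ℕ.* coeff k 0 i))
      ≡⟨ ι-∑ B _ ⟨
    ι (pair B (coeff n 0) (coeff k 0)) ∎
    where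
    open ≡-Reasoning
    lem₁ : ∀ a b c → a * (b * c) ≡ b * (a * c)
    lem₁ = solve 3 (λ a b c → a :* (b :* c) := b :* (a :* c)) refl
    lem₂ : ∀ a b c → a * b * c ≡ a * c * b
    lem₂ = solve 3 (λ a b c → a :* b :* c := a :* c :* b) refl

open import Data.Nat using (ℕ; _<_)
open import Data.Fin using (Fin)
open import Data.Product using (_×_; _,_)
open import Data.Integer using (+_)
open import Data.Rational using (_/_)
open import Function.Bundles using (_↔_)
open Counting using (pair; pair-comm; coeff; callan-↔; callanSum-pair)
open Series using (polyBernoulli-pair)

theorem7 : (n k : ℕ) → 0 < n → 0 < k →
    (Callan n k ↔ Fin (callanSum n k)) × ((+ callanSum n k) / 1 ≡ polyBernoulli n k)
theorem7 n k _ 0<k = callan-↔ n k 0<k , (begin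
  + callanSum n k / 1
    ≡⟨ cong (λ s → + s / 1) (callanSum-pair B n k 0<k (s≤s (m≤n+m k n))) ⟩
  + pair B (coeff k 0) (coeff n 0) / 1      ≡⟨ cong (λ s → + s / 1) (pair-comm B (coeff k 0) (coeff n 0)) ⟩
  + pair B (coeff n 0) (coeff k 0) / 1      ≡⟨ polyBernoulli-pair B n k (s≤s (m≤m+n n k)) ⟨
  polyBernoulli n k                         ∎)
  where
  open ≡-Reasoning
  open import Data.Nat using (_+_; s≤s)
  open import Data.Nat.Properties using (m≤m+n; m≤n+m)
  -- One cutoff above both n and k, so that the two evaluations speak of the same truncated pairing.
  B = suc (n + k)
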